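{- Let $\Gamma$ be a Moore graph of diameter $2$ and valency $57$ (if one exists). Then there exist nonnegative integers $e_1,e_2,e_3$ such that \[ K(\Gamma) \cong (\mathbb{Z}/2\mathbb{Z})^{1728} \oplus (\mathbb{Z}/13\mathbb{Z})^{1519} \oplus (\mathbb{Z}/5\mathbb{Z})^{e_1} \oplus (\mathbb{Z}/5^2\mathbb{Z})^{e_2} \oplus (\mathbb{Z}/5^3\mathbb{Z})^{e_3}. \]
   Context: A Moore graph of diameter $d$ and valency $k$ is a simple $k$-regular graph of diameter $d$ and girth $2d+1$. For a simple graph $\Gamma$ with adjacency matrix $A$ and diagonal degree matrix $D$, the Laplacian matrix is $L=D-A$, viewed as a homomorphism $\mathbb{Z}^{V(\Gamma)}\to\mathbb{Z}^{V(\Gamma)}$. The critical group $K(\Gamma)$ is the torsion subgroup of $\operatorname{coker} L=\mathbb{Z}^{V(\Gamma)}/\operatorname{im}(L)$. -}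

module Defs where

open import Data.Bool using (Bool; true; false; if_then_else_)
open import Data.Nat as ℕ using (ℕ; zero; suc)
open import Data.Fin using (Fin; zero; suc; inject₁; fromℕ)
open import Data.Integer as ℤ using (ℤ; +_; _+_; _-_; _*_)
open import Data.Integer.Divisibility as ℤDiv using ()
open import Data.List using (List; length; lookup)
open import Data.Product using (Σ; ∃; ∃-syntax; _×_)
open import Function.Definitions using (Injective)
open import Relation.Binary.PropositionalEquality using (_≡_)
open import Relation.Nullary using (¬_)
open import Data.Empty using (⊥)

sumℕ : ∀ n → (Fin n → ℕ) → ℕ
sumℕ zero    f = 0
sumℕ (suc n) f = f zero ℕ.+ sumℕ n (λ i → f (suc i))

sumℤ : ∀ n → (Fin n → ℤ) → ℤ
sumℤ zero    f = + 0
sumℤ (suc n) f = f zero + sumℤ n (λ i → f (suc i))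

record Graph (n : ℕ) : Set where
  field
    adj      : Fin n → Fin n → Bool
    symmetric : ∀ i j → adj i j ≡ adj j i
    loopless  : ∀ i → adj i i ≡ false

module _ {n : ℕ} (G : Graph n) where
  open Graph G

  Adj : Fin n → Fin n → Set
  Adj i j = adj i j ≡ true

  degree : Fin n → ℕ
  degree i = sumℕ n (λ j → if adj i j then 1 else 0)

  IsRegular : ℕ → Set
  IsRegular k = ∀ i → degree i ≡ k

  Walk : ℕ → Fin n → Fin n → Set
  Walk m u v = Σ (Fin (suc m) → Fin n) λ w →
    (w zero ≡ u) × (w (fromℕ m) ≡ v) × (∀ (i : Fin m) → Adj (w (inject₁ i)) (w (suc i)))

  DistLe : Fin n → Fin n → ℕ → Set
  DistLe u v d = ∃[ m ] (m ℕ.≤ d × Walk m u v)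

  HasDiameter : ℕ → Set
  HasDiameter d = (∀ u v → DistLe u v d)
                × (∃[ u ] ∃[ v ] (∀ m → m ℕ.< d → ¬ Walk m u v))

  Cycle : ℕ → Set
  Cycle zero    = ⊥
  Cycle (suc m) = Σ (Fin (suc m) → Fin n) λ c →
    Injective _≡_ _≡_ c
    × (∀ (i : Fin m) → Adj (c (inject₁ i)) (c (suc i)))
    × Adj (c (fromℕ m)) (c zero)

  HasGirth : ℕ → Set
  HasGirth g = Cycle g × (∀ ℓ → 3 ℕ.≤ ℓ → ℓ ℕ.< g → ¬ Cycle ℓ)

  IsMoore : ℕ → ℕ → Set
  IsMoore d k = IsRegular k × HasDiameter d × HasGirth (2 ℕ.* d ℕ.+ 1)

  Laplacian : (Fin n → ℤ) → (Fin n → ℤ)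
  Laplacian x i = (+ degree i) * x i - sumℤ n (λ j → if adj i j then x j else + 0)

  InImL : (Fin n → ℤ) → Set
  InImL x = ∃[ z ] (∀ i → Laplacian z i ≡ x i)

  -- equality in coker L = ℤ^V / im L
  _≈K_ : (Fin n → ℤ) → (Fin n → ℤ) → Set
  x ≈K y = InImL (λ i → x i - y i)

  IsTorsion : (Fin n → ℤ) → Set
  IsTorsion x = ∃[ m ] (InImL (λ i → (+ suc m) * x i))

-- The finite abelian group ⊕_i ℤ/m_iℤ for a list of moduli ms,
-- represented by ℤ^(length ms) with componentwise congruence.

module _ (ms : List ℕ) where

  _≈D_ : (Fin (length ms) → ℤ) → (Fin (length ms) → ℤ) → Set
  x ≈D y = ∀ i → (+ lookup ms i) ℤDiv.∣ (x i - y i)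

-- A group isomorphism K(Γ) ≅ ⊕_i ℤ/m_iℤ, where K(Γ) is the torsion
-- subgroup of coker L (elements: torsion representatives modulo im L).

record CriticalGroupIso {n : ℕ} (G : Graph n) (ms : List ℕ) : Set where
  private r = length ms
  field
    to        : (Fin n → ℤ) → (Fin r → ℤ)
    from      : (Fin r → ℤ) → (Fin n → ℤ)
    from-tors : ∀ y → IsTorsion G (from y)
    to-cong   : ∀ x y → IsTorsion G x → IsTorsion G y → _≈K_ G x y → _≈D_ ms (to x) (to y)
    to-hom    : ∀ x y → IsTorsion G x → IsTorsion G y →
                _≈D_ ms (to (λ i → x i + y i)) (λ i → to x i + to y i)
    from-cong : ∀ y y' → _≈D_ ms y y' → _≈K_ G (from y) (from y')
    to-from   : ∀ y → _≈D_ ms (to (from y)) y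
    from-to   : ∀ x → IsTorsion G x → _≈K_ G (from (to x)) x

{-# OPTIONS --safe #-}
-- Counting common neighbours gives A² + A − 56 I = J, so L = 57 I − A satisfies
-- L² = 115 L − 3250 I + J and L J = J L = 0 on n = 3250 vertices.  Diagonalise L = P diag(d) Q with
-- P, Q invertible over ℤ, so that coker L ≅ ⊕ ℤ/dᵢ.  Since L (115 I − L) L = 3250 L, every nonzero dᵢ
-- divides 3250 = 2·5³·13, and it remains to count the dᵢ not divisible by p for p = 0, 2, 13.
-- For this, an integral matrix T with T² = cT and p ∤ c has tr T = c · rank T, and this rank survives
-- reduction modulo p: if T = U diag(t) V, then t (V U) t = c t forces tᵢ ∣ c whenever tᵢ ≠ 0.  One chooses
-- T with the same column space as L modulo p; its trace is read off from tr L = 57 · 3250.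
module Submission where

open import Defs
import Algebra.Construct.DirectProduct as DirectProduct
import Algebra.Properties.Group as GroupProperties
import Algebra.Properties.Semiring.Sum as SemiringSum
import Algebra.Solver.Monoid as MonoidSolver
open import Algebra.Bundles using (AbelianGroup; Monoid)
open import Data.Bool using (Bool; true; false; not; if_then_else_)
import Data.Bool as Bool
open import Data.Bool.Properties using (¬-not)
open import Data.Empty using (⊥-elim)
open import Data.Fin using (Fin; zero; suc; inject₁; punchIn)
open import Data.Fin.Patterns using (0F; 1F; 2F; 3F)
open import Data.Fin.Properties using (_≟_; all?; any?; ¬∀⟶∃¬; suc-injective; punchIn-injective; punchInᵢ≢i)
open import Data.Integer using (ℤ; +_; -_; _+_; _-_; _*_; _/_; _%_; 0ℤ; 1ℤ; ≢-nonZero)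
import Data.Integer as ℤ
open import Data.Integer.DivMod using (n%d<d; a≡a%n+[a/n]*n)
open import Data.Integer.Divisibility.Signed using (_∣_; _∣?_; divides; 0∣⇒≡0; ∣-trans; ∣⇒∣ᵤ; ∣ᵤ⇒∣; m∣∣m∣; ∣m∣∣m; ∣m⇒∣-m; ∣m∣n⇒∣m+n; ∣m∣n⇒∣m-n; ∣m+n∣m⇒∣n; ∣n⇒∣m*n; ∣m⇒∣m*n)
import Data.Integer.Properties as ℤP
open import Data.Integer.Tactic.RingSolver using (solve-∀)
open import Data.List using (List; []; _∷_; _++_; length; lookup; replicate)
open import Data.List.Membership.Propositional.Properties using (∈-lookup)
open import Data.List.Relation.Unary.All using (All)
import Data.List.Relation.Unary.All as All
import Data.List.Relation.Unary.All.Properties as AllP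
open import Data.Nat using (ℕ; zero; suc; _≤_; _<_; z≤n; s≤s)
import Data.Nat as ℕ
import Data.Nat.Coprimality as ℕC
import Data.Nat.Divisibility as ℕD
open import Data.Nat.Induction using (Acc; acc; <-wellFounded)
open import Data.Nat.Primality using (Prime; prime?; euclidsLemma; prime⇒irreducible; prime⇒nonZero)
import Data.Nat.Properties as ℕP
import Data.Nat.Tactic.RingSolver as ℕSolver
open import Data.Product using (∃-syntax; _×_; _,_; proj₁; proj₂)
open import Data.Sum using (_⊎_; inj₁; inj₂)
import Data.Sum as Sum
open import Data.Vec.Functional using () renaming (_∷_ to _∷ᶠ_)
open import Function using (_∘_; id; mk⇔)
open import Function.Definitions using (Injective)
open import Level using (0ℓ)
open import Relation.Binary.PropositionalEquality using (_≡_; _≗_; refl; sym; trans; cong; cong₂; subst; subst₂; module ≡-Reasoning)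
import Relation.Binary.Reasoning.Setoid as SetoidReasoning
open import Relation.Nullary using (¬_; Dec; yes; no; contradiction; does; ¬?; decidable-stable)
open import Relation.Nullary.Decidable using (from-yes; from-no; dec-true; dec-false; does-⇔)

open SemiringSum ℤP.+-*-semiring using (sum; sum-cong-≗; ∑-distrib-+; ∑-comm; *-distribˡ-sum; *-distribʳ-sum; sum-replicate-zero)

-- Integer matrices

-- The nonzero eigenvalues of `L` are 50 and 65, with product 3250 and sum 115. Modulo 2 the
-- eigenvalue 50 merges with 0, modulo 13 the eigenvalue 65 does, so the rank drops; the other
-- eigenvalue `ℓ` stays apart from 0, and the scaled projection `E` onto its eigenspace survives
-- reduction. The image of `L` modulo p is slightly larger: `J` ≡ `L`² - 115 `L`, so it also
-- contains the all-ones vector. As `J`² = 3250 `J` ≡ 0, the matrix `J` cannot supply the missing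
-- idempotent; a rank-one matrix built from a row of the complementary projection does. This gives
-- ranks 1520 + 1 modulo 2 and 1729 + 1 modulo 13. Since 2 and 13 divide 3250 exactly once, these
-- ranks determine how often ℤ/2 and ℤ/13 occur. The prime 5 divides both eigenvalues, hence also
-- the scaling factor of `T`, so the method says nothing about the exponents of its three cyclic
-- groups. Primality enters only as Euclid's lemma on divisibility in ℤ, so no matrices over finite
-- fields appear and p = 0 yields the rank over ℚ by the same argument.

sum-zero : ∀ {n} (f : Fin n → ℤ) → (∀ i → f i ≡ 0ℤ) → sum f ≡ 0ℤ
sum-zero {n} f f≡0 = trans (sum-cong-≗ f≡0) (sum-replicate-zero n)

sum-const : ∀ n a → sum {n} (λ _ → a) ≡ + n * a
sum-const zero    a = sym (ℤP.*-zeroˡ a)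
sum-const (suc n) a = trans (cong (_+_ a) (sum-const n a)) (sym (ℤP.suc-* (+ n) a))

sum-neg : ∀ {n} (f : Fin n → ℤ) → sum (λ i → - f i) ≡ - sum f
sum-neg {zero}  f = refl
sum-neg {suc n} f = trans (cong (_+_ (- f zero)) (sum-neg (f ∘ suc))) (sym (ℤP.neg-distrib-+ (f zero) _))

sum-supported : ∀ {n} (f : Fin n → ℤ) k → (∀ i → ¬ i ≡ k → f i ≡ 0ℤ) → sum f ≡ f k
sum-supported f zero    off = trans (cong (_+_ (f zero)) (sum-zero (f ∘ suc) (λ i → off (suc i) λ ()))) (ℤP.+-identityʳ _)
sum-supported f (suc k) off = trans (cong₂ _+_ (off zero λ ()) (sum-supported (f ∘ suc) k λ i i≢k → off (suc i) (i≢k ∘ suc-injective)))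
  (ℤP.+-identityˡ _)

Mat : ℕ → Set
Mat n = Fin n → Fin n → ℤ

δ : ∀ {n} → Fin n → Fin n → ℤ
δ zero    zero    = 1ℤ
δ zero    (suc _) = 0ℤ
δ (suc _) zero    = 0ℤ
δ (suc i) (suc j) = δ i j

δ-diag : ∀ {n} (i : Fin n) → δ i i ≡ 1ℤ
δ-diag zero    = refl
δ-diag (suc i) = δ-diag i

δ-off : ∀ {n} {i j : Fin n} → ¬ i ≡ j → δ i j ≡ 0ℤ
δ-off {i = zero}  {zero}  i≢j = contradiction refl i≢j
δ-off {i = zero}  {suc j} i≢j = refl
δ-off {i = suc i} {zero}  i≢j = refl
δ-off {i = suc i} {suc j} i≢j = δ-off (i≢j ∘ cong suc)

sum-δˡ : ∀ {n} i (f : Fin n → ℤ) → sum (λ k → δ i k * f k) ≡ f i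
sum-δˡ i f = trans (sum-supported _ i λ k k≢i → trans (cong (_* f k) (δ-off (k≢i ∘ sym))) (ℤP.*-zeroˡ (f k)))
  (trans (cong (_* f i) (δ-diag i)) (ℤP.*-identityˡ (f i)))

sum-δʳ : ∀ {n} j (f : Fin n → ℤ) → sum (λ k → f k * δ k j) ≡ f j
sum-δʳ j f = trans (sum-supported _ j λ k k≢j → trans (cong (f k *_) (δ-off k≢j)) (ℤP.*-zeroʳ (f k)))
  (trans (cong (f j *_) (δ-diag j)) (ℤP.*-identityʳ (f j)))

infix 4 _≋_
infixl 7 _⊗_
infixl 6 _⊕_
infixr 8 _·_

-- A record and not a bare family of equations, so that both matrices can be recovered from the type
-- during unification.
record _≋_ {n} (A B : Mat n) : Set where
  constructor ext
  field at : ∀ i j → A i j ≡ B i j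

open _≋_

_⊗_ _⊕_ : ∀ {n} → Mat n → Mat n → Mat n
(A ⊗ B) i j = sum λ k → A i k * B k j
(A ⊕ B) i j = A i j + B i j

_·_ : ∀ {n} → ℤ → Mat n → Mat n
(c · A) i j = c * A i j

diag : ∀ {n} → (Fin n → ℤ) → Mat n
diag d i j = d i * δ i j

tr : ∀ {n} → Mat n → ℤ
tr A = sum λ i → A i i

⊗-cong : ∀ {n} {A A′ B B′ : Mat n} → A ≋ A′ → B ≋ B′ → A ⊗ B ≋ A′ ⊗ B′
⊗-cong A≋ B≋ = ext λ i j → sum-cong-≗ λ k → cong₂ _*_ (at A≋ i k) (at B≋ k j)

⊗-assoc : ∀ {n} (A B C : Mat n) → (A ⊗ B) ⊗ C ≋ A ⊗ (B ⊗ C)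
⊗-assoc A B C = ext λ i j → begin
  sum (λ k → sum (λ l → A i l * B l k) * C k j)   ≡⟨ sum-cong-≗ (λ k → *-distribʳ-sum (C k j) (λ l → A i l * B l k)) ⟩
  sum (λ k → sum (λ l → A i l * B l k * C k j))   ≡⟨ ∑-comm (λ k l → A i l * B l k * C k j) ⟩
  sum (λ l → sum (λ k → A i l * B l k * C k j))   ≡⟨ sum-cong-≗ (λ l → sum-cong-≗ λ k → ℤP.*-assoc (A i l) (B l k) (C k j)) ⟩
  sum (λ l → sum (λ k → A i l * (B l k * C k j))) ≡⟨ sum-cong-≗ (λ l → sym (*-distribˡ-sum (A i l) (λ k → B l k * C k j))) ⟩
  sum (λ l → A i l * sum (λ k → B l k * C k j))   ∎
  where open ≡-Reasoning

⊗-monoid : ℕ → Monoid 0ℓ 0ℓ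
⊗-monoid n = record
  { Carrier  = Mat n
  ; _≈_      = _≋_
  ; _∙_      = _⊗_
  ; ε        = δ
  ; isMonoid = record
    { isSemigroup = record
      { isMagma = record
        { isEquivalence = record
          { refl  = ext λ i j → refl
          ; sym   = λ p → ext λ i j → sym (at p i j)
          ; trans = λ p q → ext λ i j → trans (at p i j) (at q i j)
          }
        ; ∙-cong = ⊗-cong
        }
      ; assoc = ⊗-assoc
      }
    ; identity = (λ A → ext λ i j → sum-δˡ i (λ k → A k j)) , λ A → ext λ i j → sum-δʳ j (A i)
    }
  }

⊗-distribˡ : ∀ {n} (A B C : Mat n) → A ⊗ (B ⊕ C) ≋ A ⊗ B ⊕ A ⊗ C
⊗-distribˡ A B C = ext λ i j → trans (sum-cong-≗ λ k → ℤP.*-distribˡ-+ (A i k) (B k j) (C k j)) (∑-distrib-+ (λ k → A i k * B k j) _)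

⊗-distribʳ : ∀ {n} (A B C : Mat n) → (B ⊕ C) ⊗ A ≋ B ⊗ A ⊕ C ⊗ A
⊗-distribʳ A B C = ext λ i j → trans (sum-cong-≗ λ k → ℤP.*-distribʳ-+ (A k j) (B i k) (C i k)) (∑-distrib-+ (λ k → B i k * A k j) _)

·-⊗ : ∀ {n} c (A B : Mat n) → (c · A) ⊗ B ≋ c · (A ⊗ B)
·-⊗ c A B = ext λ i j → trans (sum-cong-≗ λ k → ℤP.*-assoc c (A i k) (B k j)) (sym (*-distribˡ-sum c (λ k → A i k * B k j)))

⊗-· : ∀ {n} c (A B : Mat n) → A ⊗ (c · B) ≋ c · (A ⊗ B)
⊗-· c A B = ext λ i j → trans (sum-cong-≗ λ k → swap (A i k) c (B k j)) (sym (*-distribˡ-sum c (λ k → A i k * B k j)))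
  where
  swap : ∀ a c b → a * (c * b) ≡ c * (a * b)
  swap = solve-∀

tr-comm : ∀ {n} (A B : Mat n) → tr (A ⊗ B) ≡ tr (B ⊗ A)
tr-comm A B = trans (∑-comm (λ i k → A i k * B k i)) (sum-cong-≗ λ k → sum-cong-≗ λ i → ℤP.*-comm (A i k) (B k i))

diag-⊗ : ∀ {n} (d : Fin n → ℤ) (A : Mat n) i j → (diag d ⊗ A) i j ≡ d i * A i j
diag-⊗ d A i j = trans (at (·-⊗ (d i) δ A) i j) (cong (d i *_) (sum-δˡ i λ k → A k j))

⊗-diag : ∀ {n} (d : Fin n → ℤ) (A : Mat n) i j → (A ⊗ diag d) i j ≡ A i j * d j
⊗-diag d A i j = trans (sum-cong-≗ λ k → sym (ℤP.*-assoc (A i k) (d k) (δ k j))) (sum-δʳ j λ k → A i k * d k)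

module _ {n : ℕ} where
  open Monoid (⊗-monoid n) public using () renaming (refl to ≋-refl; sym to ≋-sym; trans to ≋-trans; identityˡ to ⊗-identityˡ; identityʳ to ⊗-identityʳ; setoid to ≋-setoid)

module ≋-Reasoning {n : ℕ} where
  open SetoidReasoning (≋-setoid {n}) public

⊗-congˡ : ∀ {n} (A : Mat n) {B B′ : Mat n} → B ≋ B′ → A ⊗ B ≋ A ⊗ B′
⊗-congˡ A = ⊗-cong (≋-refl {x = A})

⊗-congʳ : ∀ {n} (B : Mat n) {A A′ : Mat n} → A ≋ A′ → A ⊗ B ≋ A′ ⊗ B
⊗-congʳ B A≋A′ = ⊗-cong A≋A′ (≋-refl {x = B})

-- Diagonal form over ℤ

_ᵀ : ∀ {n} → Mat n → Mat n
(A ᵀ) i j = A j i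

ᵀ-⊗ : ∀ {n} (A B : Mat n) → (A ⊗ B) ᵀ ≋ B ᵀ ⊗ A ᵀ
ᵀ-⊗ A B = ext λ i j → sum-cong-≗ λ k → ℤP.*-comm (A j k) (B k i)

δ-sym : ∀ {n} (i j : Fin n) → δ i j ≡ δ j i
δ-sym zero    zero    = refl
δ-sym zero    (suc _) = refl
δ-sym (suc _) zero    = refl
δ-sym (suc i) (suc j) = δ-sym i j

record Invertible {n} (A : Mat n) : Set where
  constructor invertible
  field
    inv  : Mat n
    invʳ : A ⊗ inv ≋ δ
    invˡ : inv ⊗ A ≋ δ

δ-invertible : ∀ {n} → Invertible {n} δ
δ-invertible = invertible δ (⊗-identityˡ δ) (⊗-identityˡ δ)

cancel-inner : ∀ {n} (A B C D : Mat n) → B ⊗ C ≋ δ → A ⊗ D ≋ δ → (A ⊗ B) ⊗ (C ⊗ D) ≋ δ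
cancel-inner {n} A B C D BC AD = begin
  (A ⊗ B) ⊗ (C ⊗ D)   ≈⟨ ⊗-assoc A B (C ⊗ D) ⟩
  A ⊗ (B ⊗ (C ⊗ D))   ≈⟨ ⊗-congˡ A (≋-sym (⊗-assoc B C D)) ⟩
  A ⊗ ((B ⊗ C) ⊗ D)   ≈⟨ ⊗-congˡ A (⊗-congʳ D BC) ⟩
  A ⊗ (δ ⊗ D)         ≈⟨ ⊗-congˡ A (⊗-identityˡ D) ⟩
  A ⊗ D               ≈⟨ AD ⟩
  δ                   ∎
  where
  open ≋-Reasoning

⊗-invertible : ∀ {n} {A B : Mat n} → Invertible A → Invertible B → Invertible (A ⊗ B)
⊗-invertible {A = A} {B} (invertible A′ AA′ A′A) (invertible B′ BB′ B′B) = invertible (B′ ⊗ A′)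
  (cancel-inner A B B′ A′ BB′ AA′) (cancel-inner B′ A′ A B A′A B′B)

ᵀ-invertible : ∀ {n} {A : Mat n} → Invertible A → Invertible (A ᵀ)
ᵀ-invertible {A = A} (invertible A′ AA′ A′A) = invertible (A′ ᵀ)
  (ext λ i j → trans (sym (at (ᵀ-⊗ A′ A) i j)) (trans (at A′A j i) (δ-sym j i)))
  (ext λ i j → trans (sym (at (ᵀ-⊗ A A′) i j)) (trans (at AA′ j i) (δ-sym j i)))

infix 4 _~_

record _~_ {n} (M N : Mat n) : Set where
  constructor equivalent
  field
    {P Q}  : Mat n
    P-inv  : Invertible P
    Q-inv  : Invertible Q
    factor : M ≋ P ⊗ N ⊗ Q

≋⇒~ : ∀ {n} {M N : Mat n} → M ≋ N → M ~ N
≋⇒~ {N = N} M≋N = equivalent δ-invertible δ-invertible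
  (≋-trans M≋N (≋-sym (≋-trans (⊗-identityʳ (δ ⊗ N)) (⊗-identityˡ N))))

~-trans : ∀ {n} {M N O : Mat n} → M ~ N → N ~ O → M ~ O
~-trans {n} {M} {N} {O} (equivalent {P} {Q} P-inv Q-inv M≋) (equivalent {P′} {Q′} P′-inv Q′-inv N≋) =
  equivalent (⊗-invertible P-inv P′-inv) (⊗-invertible Q′-inv Q-inv) (begin
    M                             ≈⟨ M≋ ⟩
    P ⊗ N ⊗ Q                     ≈⟨ ⊗-congʳ Q (⊗-congˡ P N≋) ⟩
    P ⊗ (P′ ⊗ O ⊗ Q′) ⊗ Q         ≈⟨ ⊗-congʳ Q (≋-sym (⊗-assoc P (P′ ⊗ O) Q′)) ⟩
    P ⊗ (P′ ⊗ O) ⊗ Q′ ⊗ Q         ≈⟨ ⊗-assoc (P ⊗ (P′ ⊗ O)) Q′ Q ⟩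
    P ⊗ (P′ ⊗ O) ⊗ (Q′ ⊗ Q)       ≈⟨ ⊗-congʳ (Q′ ⊗ Q) (≋-sym (⊗-assoc P P′ O)) ⟩
    (P ⊗ P′) ⊗ O ⊗ (Q′ ⊗ Q)       ∎)
  where
  open ≋-Reasoning

ᵀ-~ : ∀ {n} {M N : Mat n} → M ~ N → M ᵀ ~ N ᵀ
ᵀ-~ {n} {M} {N} (equivalent {P} {Q} P-inv Q-inv M≋) = equivalent (ᵀ-invertible Q-inv) (ᵀ-invertible P-inv) (begin
  M ᵀ                     ≈⟨ ext (λ i j → at M≋ j i) ⟩
  (P ⊗ N ⊗ Q) ᵀ           ≈⟨ ᵀ-⊗ (P ⊗ N) Q ⟩
  Q ᵀ ⊗ (P ⊗ N) ᵀ         ≈⟨ ⊗-congˡ (Q ᵀ) (ᵀ-⊗ P N) ⟩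
  Q ᵀ ⊗ (N ᵀ ⊗ P ᵀ)       ≈⟨ ⊗-assoc (Q ᵀ) (N ᵀ) (P ᵀ) ⟨
  Q ᵀ ⊗ N ᵀ ⊗ P ᵀ         ∎)
  where
  open ≋-Reasoning

-- Row operations as transvections `I + u wᵀ`

transvection : ∀ {n} → (u w : Fin n → ℤ) → Mat n
transvection u w i j = δ i j + u i * w j

transvection-⊗ : ∀ {n} (u w : Fin n → ℤ) (A : Mat n) i j →
  (transvection u w ⊗ A) i j ≡ A i j + u i * sum (λ k → w k * A k j)
transvection-⊗ u w A i j = begin
  sum (λ k → (δ i k + u i * w k) * A k j)
    ≡⟨ sum-cong-≗ (λ k → expand (δ i k) (u i) (w k) (A k j)) ⟩
  sum (λ k → δ i k * A k j + u i * (w k * A k j))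
    ≡⟨ ∑-distrib-+ (λ k → δ i k * A k j) (λ k → u i * (w k * A k j)) ⟩
  sum (λ k → δ i k * A k j) + sum (λ k → u i * (w k * A k j))
    ≡⟨ cong₂ _+_ (sum-δˡ i (λ k → A k j)) (sym (*-distribˡ-sum (u i) (λ k → w k * A k j))) ⟩
  A i j + u i * sum (λ k → w k * A k j) ∎
  where
  open ≡-Reasoning
  expand : ∀ d u w a → (d + u * w) * a ≡ d * a + u * (w * a)
  expand = solve-∀

-- The product is `I + (u + v) wᵀ + u (w·v) wᵀ`, and both corrections vanish. Keeping `v` separate
-- from `- u` lets one statement give the inverse on either side.
transvection-inv : ∀ {n} (u v w : Fin n → ℤ) → (∀ i → u i + v i ≡ 0ℤ) → sum (λ k → w k * v k) ≡ 0ℤ →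
  transvection u w ⊗ transvection v w ≋ δ
transvection-inv u v w u+v≡0 w·v≡0 = ext λ i j → begin
  (transvection u w ⊗ transvection v w) i j
    ≡⟨ transvection-⊗ u w (transvection v w) i j ⟩
  δ i j + v i * w j + u i * sum (λ k → w k * (δ k j + v k * w j))
    ≡⟨ cong (λ s → δ i j + v i * w j + u i * s) (begin
      sum (λ k → w k * (δ k j + v k * w j))               ≡⟨ sum-cong-≗ (λ k → expand (w k) (δ k j) (v k) (w j)) ⟩
      sum (λ k → w k * δ k j + w k * v k * w j)           ≡⟨ ∑-distrib-+ (λ k → w k * δ k j) (λ k → w k * v k * w j) ⟩
      sum (λ k → w k * δ k j) + sum (λ k → w k * v k * w j)
        ≡⟨ cong₂ _+_ (sum-δʳ j w) (sym (*-distribʳ-sum (w j) (λ k → w k * v k))) ⟩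
      w j + sum (λ k → w k * v k) * w j                   ≡⟨ cong (λ s → w j + s * w j) w·v≡0 ⟩
      w j + 0ℤ * w j                                      ≡⟨ drop (w j) ⟩
      w j                                                 ∎) ⟩
  δ i j + v i * w j + u i * w j                           ≡⟨ collect (δ i j) (u i) (v i) (w j) ⟩
  δ i j + (u i + v i) * w j                               ≡⟨ cong (λ s → δ i j + s * w j) (u+v≡0 i) ⟩
  δ i j + 0ℤ * w j                                        ≡⟨ drop′ (δ i j) (w j) ⟩
  δ i j                                                   ∎
  where
  open ≡-Reasoning
  expand : ∀ w d v x → w * (d + v * x) ≡ w * d + w * v * x
  expand = solve-∀
  drop : ∀ x → x + 0ℤ * x ≡ x
  drop = solve-∀
  drop′ : ∀ d x → d + 0ℤ * x ≡ d
  drop′ = solve-∀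
  collect : ∀ d u v w → d + v * w + u * w ≡ d + (u + v) * w
  collect = solve-∀

add-rows : ∀ {n} (u w : Fin n → ℤ) → Mat n → Mat n
add-rows u w M i j = M i j + u i * sum (λ k → w k * M k j)

row-transvection : ∀ {n} (u w : Fin n → ℤ) → sum (λ k → w k * u k) ≡ 0ℤ → (M : Mat n) →
  M ~ add-rows u w M
row-transvection {n} u w w·u≡0 M = equivalent
  (invertible (transvection u w) v-u u-v)
  δ-invertible
  (≋-sym (begin
    transvection v w ⊗ M′ ⊗ δ                   ≈⟨ ⊗-identityʳ (transvection v w ⊗ M′) ⟩
    transvection v w ⊗ M′                       ≈⟨ ⊗-congˡ (transvection v w) (ext (transvection-⊗ u w M)) ⟨
    transvection v w ⊗ (transvection u w ⊗ M)   ≈⟨ ⊗-assoc (transvection v w) (transvection u w) M ⟨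
    transvection v w ⊗ transvection u w ⊗ M     ≈⟨ ⊗-congʳ M v-u ⟩
    δ ⊗ M                                       ≈⟨ ⊗-identityˡ M ⟩
    M                                           ∎))
  where
  open ≋-Reasoning
  M′ : Mat n
  M′ = add-rows u w M
  v : Fin n → ℤ
  v i = - u i
  w·v≡0 : sum (λ k → w k * v k) ≡ 0ℤ
  w·v≡0 = trans (sum-cong-≗ λ k → sym (ℤP.neg-distribʳ-* (w k) (u k)))
    (trans (sum-neg (λ k → w k * u k)) (cong -_ w·u≡0))
  v-u : transvection v w ⊗ transvection u w ≋ δ
  v-u = transvection-inv v u w (λ i → ℤP.+-inverseˡ (u i)) w·u≡0
  u-v : transvection u w ⊗ transvection v w ≋ δ
  u-v = transvection-inv u v w (λ i → ℤP.+-inverseʳ (u i)) w·v≡0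

-- The transvection with u = e₀ + c eᵢ and w = eᵢ − c e₀; for c = 1 + q it moves the remainder
-- M (suc i) zero − q · M zero zero into the corner.
shear : ∀ {n} (M : Mat (suc n)) i c →
  ∃[ M′ ] M ~ M′ × M′ zero zero ≡ M zero zero + (M (suc i) zero - c * M zero zero)
shear {n} M i c = M′ , row-transvection u w w·u≡0 M , cong (_+_ (M zero zero)) M′₀₀
  where
  open ≡-Reasoning
  u w : Fin (suc n) → ℤ
  u zero    = 1ℤ
  u (suc k) = c * δ i k
  w zero    = - c
  w (suc k) = δ i k
  M′ : Mat (suc n)
  M′ = add-rows u w M
  w· : ∀ f → sum (λ k → w k * f k) ≡ - c * f zero + f (suc i)
  w· f = cong (_+_ (- c * f zero)) (sum-δˡ i (λ k → f (suc k)))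
  w·u≡0 : sum (λ k → w k * u k) ≡ 0ℤ
  w·u≡0 = begin
    sum (λ k → w k * u k)    ≡⟨ w· u ⟩
    - c * 1ℤ + c * δ i i     ≡⟨ cong (λ d → - c * 1ℤ + c * d) (δ-diag i) ⟩
    - c * 1ℤ + c * 1ℤ        ≡⟨ cong₂ _+_ (ℤP.*-identityʳ (- c)) (ℤP.*-identityʳ c) ⟩
    - c + c                  ≡⟨ ℤP.+-inverseˡ c ⟩
    0ℤ                       ∎
  reorder : ∀ c a x → - c * a + x ≡ x - c * a
  reorder = solve-∀
  M′₀₀ : u zero * sum (λ k → w k * M k zero) ≡ M (suc i) zero - c * M zero zero
  M′₀₀ = begin
    u zero * sum (λ k → w k * M k zero)    ≡⟨ ℤP.*-identityˡ (sum (λ k → w k * M k zero)) ⟩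
    sum (λ k → w k * M k zero)             ≡⟨ w· (λ k → M k zero) ⟩
    - c * M zero zero + M (suc i) zero     ≡⟨ reorder c (M zero zero) (M (suc i) zero) ⟩
    M (suc i) zero - c * M zero zero       ∎

pivot-from-column : ∀ {n} (M : Mat (suc n)) i q →
  ∃[ M′ ] M ~ M′ × M′ zero zero ≡ M (suc i) zero - q * M zero zero
pivot-from-column M i q =
  let M′ , M~M′ , eq = shear M i (1ℤ + q)
  in M′ , M~M′ , trans eq (simplify (M zero zero) q (M (suc i) zero))
  where
  simplify : ∀ a q x → a + (x - (1ℤ + q) * a) ≡ x - q * a
  simplify = solve-∀

pivot-from-row : ∀ {n} (M : Mat (suc n)) j q →
  ∃[ M′ ] M ~ M′ × M′ zero zero ≡ M zero (suc j) - q * M zero zero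
pivot-from-row M j q = let M′ , M~ , eq = pivot-from-column (M ᵀ) j q in M′ ᵀ , ᵀ-~ M~ , eq

clear-column : ∀ {n} (M : Mat (suc n)) → (∀ i → M zero zero ∣ M (suc i) zero) →
  ∃[ M′ ] M ~ M′ × (∀ j → M′ zero j ≡ M zero j) × (∀ i → M′ (suc i) zero ≡ 0ℤ)
clear-column {n} M a∣ = M′ , row-transvection u w w·u≡0 M , (λ j → ℤP.+-identityʳ (M zero j)) ,
  λ i → trans (M′-suc i zero) (begin
    M (suc i) zero - q i * M zero zero      ≡⟨ cong (_- q i * M zero zero) (_∣_.equality (a∣ i)) ⟩
    q i * M zero zero - q i * M zero zero   ≡⟨ ℤP.+-inverseʳ (q i * M zero zero) ⟩
    0ℤ ∎)
  where
  open ≡-Reasoning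
  q : Fin n → ℤ
  q i = _∣_.quotient (a∣ i)
  u w : Fin (suc n) → ℤ
  u zero    = 0ℤ
  u (suc i) = - q i
  w zero    = 1ℤ
  w (suc _) = 0ℤ
  w·u≡0 : sum (λ k → w k * u k) ≡ 0ℤ
  w·u≡0 = sum-zero (λ k → w k * u k) λ { zero → refl ; (suc i) → ℤP.*-zeroˡ (- q i) }
  M′ : Mat (suc n)
  M′ = add-rows u w M
  simplify : ∀ x q a → x + - q * (1ℤ * a + 0ℤ) ≡ x - q * a
  simplify = solve-∀
  M′-suc : ∀ i j → M′ (suc i) j ≡ M (suc i) j - q i * M zero j
  M′-suc i j = trans
    (cong (λ s → M (suc i) j + - q i * (1ℤ * M zero j + s)) (sum-zero (λ k → 0ℤ * M (suc k) j) λ k → ℤP.*-zeroˡ (M (suc k) j)))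
    (simplify (M (suc i) j) (q i) (M zero j))

clear-row : ∀ {n} (M : Mat (suc n)) → (∀ j → M zero zero ∣ M zero (suc j)) →
  ∃[ M′ ] M ~ M′ × (∀ i → M′ i zero ≡ M i zero) × (∀ j → M′ zero (suc j) ≡ 0ℤ)
clear-row M a∣ = let M′ , M~ , col , row = clear-column (M ᵀ) a∣ in M′ ᵀ , ᵀ-~ M~ , col , row

-- Splitting off a corner entry by Euclidean reduction

block : ∀ {n} → ℤ → Mat n → Mat (suc n)
block a A zero    zero    = a
block a A zero    (suc j) = 0ℤ
block a A (suc i) zero    = 0ℤ
block a A (suc i) (suc j) = A i j

block-⊗-at : ∀ {n} a b (A B : Mat n) i j → (block a A ⊗ block b B) i j ≡ block (a * b) (A ⊗ B) i j
block-⊗-at {n} a b A B zero zero  = trans (cong (_+_ (a * b)) (sum-zero (λ (k : Fin n) → 0ℤ * 0ℤ) λ _ → refl)) (ℤP.+-identityʳ (a * b))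
block-⊗-at a b A B zero    (suc j) = cong₂ _+_ (ℤP.*-zeroʳ a) (sum-zero (λ k → 0ℤ * B k j) λ k → ℤP.*-zeroˡ (B k j))
block-⊗-at a b A B (suc i) zero    = cong₂ _+_ (ℤP.*-zeroˡ b) (sum-zero (λ k → A i k * 0ℤ) λ k → ℤP.*-zeroʳ (A i k))
block-⊗-at a b A B (suc i) (suc j) = ℤP.+-identityˡ ((A ⊗ B) i j)

block-⊗ : ∀ {n} a b (A B : Mat n) → block a A ⊗ block b B ≋ block (a * b) (A ⊗ B)
block-⊗ a b A B = ext (block-⊗-at a b A B)

block-cong : ∀ {n} {a b} {A B : Mat n} → a ≡ b → A ≋ B → block a A ≋ block b B
block-cong {a = a} {b} {A} {B} a≡b A≋B = ext pointwise
  where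
  pointwise : ∀ i j → block a A i j ≡ block b B i j
  pointwise zero    zero    = a≡b
  pointwise zero    (suc j) = refl
  pointwise (suc i) zero    = refl
  pointwise (suc i) (suc j) = at A≋B i j

block-δ : ∀ {n} → block 1ℤ (δ {n}) ≋ δ
block-δ = ext λ where
  zero    zero    → refl
  zero    (suc j) → refl
  (suc i) zero    → refl
  (suc i) (suc j) → refl

block-invertible : ∀ {n} {A : Mat n} → Invertible A → Invertible (block 1ℤ A)
block-invertible {A = A} (invertible A′ AA′ A′A) = invertible (block 1ℤ A′)
  (≋-trans (block-⊗ 1ℤ 1ℤ A A′) (≋-trans (block-cong refl AA′) block-δ))
  (≋-trans (block-⊗ 1ℤ 1ℤ A′ A) (≋-trans (block-cong refl A′A) block-δ))

block-~ : ∀ {n} a {A B : Mat n} → A ~ B → block a A ~ block a B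
block-~ {n} a {A} {B} (equivalent {P} {Q} P-inv Q-inv A≋) = equivalent (block-invertible P-inv) (block-invertible Q-inv) (begin
  block a A                              ≈⟨ block-cong (sym (trans (ℤP.*-identityʳ (1ℤ * a)) (ℤP.*-identityˡ a))) A≋ ⟩
  block (1ℤ * a * 1ℤ) (P ⊗ B ⊗ Q)        ≈⟨ ≋-sym (block-⊗ (1ℤ * a) 1ℤ (P ⊗ B) Q) ⟩
  block (1ℤ * a) (P ⊗ B) ⊗ block 1ℤ Q    ≈⟨ ⊗-congʳ (block 1ℤ Q) (≋-sym (block-⊗ 1ℤ a P B)) ⟩
  block 1ℤ P ⊗ block a B ⊗ block 1ℤ Q    ∎)
  where
  open ≋-Reasoning

block-of-cross : ∀ {n} (M : Mat (suc n)) {a} → M zero zero ≡ a →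
  (∀ i → M (suc i) zero ≡ 0ℤ) → (∀ j → M zero (suc j) ≡ 0ℤ) → M ≋ block a (λ i j → M (suc i) (suc j))
block-of-cross M {a} corner col row = ext pointwise
  where
  pointwise : ∀ i j → M i j ≡ block a (λ i j → M (suc i) (suc j)) i j
  pointwise zero    zero    = corner
  pointwise zero    (suc j) = row j
  pointwise (suc i) zero    = col i
  pointwise (suc i) (suc j) = refl

split-divisible : ∀ {n} (M : Mat (suc n)) → (∀ i → M zero zero ∣ M (suc i) zero) → (∀ j → M zero zero ∣ M zero (suc j)) →
  ∃[ A ] M ~ block (M zero zero) A
split-divisible M col row =
  let M′ , M~M′ , row₀ , col₀ = clear-column M col
      -- Clearing the column left row zero intact, so its divisibility persists; clearing the row in
      -- turn keeps the column already cleared.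
      M″ , M′~M″ , col₁ , row₁ = clear-row M′ (λ j → subst₂ _∣_ (sym (row₀ zero)) (sym (row₀ (suc j))) (row j))
  in _ , ~-trans M~M′ (~-trans M′~M″ (≋⇒~
       (block-of-cross M″ (trans (col₁ zero) (row₀ zero)) (λ i → trans (col₁ (suc i)) (col₀ i)) row₁)))

-- The second alternative leaves `q` open because it serves twice: with the Euclidean quotient it
-- shrinks a nonzero corner, and with `q = 0` it moves a nonzero entry into a zero corner.
split-or-pivot : ∀ {n} (M : Mat (suc n)) →
  (∃[ A ] M ~ block (M zero zero) A) ⊎
  (∃[ x ] ¬ (M zero zero ∣ x) × ∀ q → ∃[ M′ ] M ~ M′ × M′ zero zero ≡ x - q * M zero zero)
split-or-pivot {n} M with all? (λ i → M zero zero ∣? M (suc i) zero) | all? (λ j → M zero zero ∣? M zero (suc j))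
... | no ¬col | _ =
  let i , a∤x = ¬∀⟶∃¬ n _ (λ i → M zero zero ∣? M (suc i) zero) ¬col
  in inj₂ (M (suc i) zero , a∤x , pivot-from-column M i)
... | yes _ | no ¬row =
  let j , a∤x = ¬∀⟶∃¬ n _ (λ j → M zero zero ∣? M zero (suc j)) ¬row
  in inj₂ (M zero (suc j) , a∤x , pivot-from-row M j)
... | yes col | yes row = inj₁ (split-divisible M col row)

-- Euclid's algorithm on the corner: an entry not divisible by it leaves a remainder that is nonzero
-- and of smaller absolute value, and this remainder becomes the new corner.
split-nonZero : ∀ {n} (M : Mat (suc n)) → ¬ M zero zero ≡ 0ℤ → Acc _<_ ℤ.∣ M zero zero ∣ → ∃[ a ] ∃[ A ] M ~ block a A
split-nonZero M a≢0 (acc rec) with split-or-pivot M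
... | inj₁ (A , M~) = _ , A , M~
... | inj₂ (x , a∤x , pivot)
  with M′ , M~M′ , eq ← pivot (_/_ x (M zero zero) {{≢-nonZero a≢0}}) =
  let r≡ = trans eq remainder
      a , A , M′~ = split-nonZero M′ (λ M′₀₀≡0 → a∤x (divides q (exact (trans (sym r≡) M′₀₀≡0))))
        (rec (subst (λ z → ℤ.∣ z ∣ < ℤ.∣ M zero zero ∣) (sym r≡) (n%d<d x (M zero zero))))
  in a , A , ~-trans M~M′ M′~
  where
  instance _ = ≢-nonZero a≢0
  q r : ℤ
  q = x / M zero zero
  r = + (x % M zero zero)
  cancel : ∀ r s → r + s - s ≡ r
  cancel = solve-∀
  remainder : x - q * M zero zero ≡ r
  remainder = trans (cong (_- q * M zero zero) (a≡a%n+[a/n]*n x (M zero zero))) (cancel r (q * M zero zero))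
  exact : r ≡ 0ℤ → x ≡ q * M zero zero
  exact r≡0 = trans (a≡a%n+[a/n]*n x (M zero zero)) (trans (cong (_+ q * M zero zero) r≡0) (ℤP.+-identityˡ _))

split : ∀ {n} (M : Mat (suc n)) → ∃[ a ] ∃[ A ] M ~ block a A
split M with M zero zero ℤP.≟ 0ℤ
... | no a≢0 = split-nonZero M a≢0 (<-wellFounded _)
... | yes a≡0 with split-or-pivot M
...   | inj₁ (A , M~) = _ , A , M~
...   | inj₂ (x , a∤x , pivot) with M′ , M~M′ , eq ← pivot 0ℤ =
  let a , A , M′~ = split-nonZero M′ (λ M′₀₀≡0 → a∤x (divides 0ℤ (trans (sym (drop x (M zero zero))) (trans (sym eq) M′₀₀≡0)))) (<-wellFounded _)
  in a , A , ~-trans M~M′ M′~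
  where
  drop : ∀ x a → x - 0ℤ * a ≡ x
  drop = solve-∀

-- Weaker than Smith normal form: the entries form no divisibility chain, since only the direct sum
-- of cyclic groups and the number of entries divisible by a given prime are read off.
diagonalise : ∀ {n} (M : Mat n) → ∃[ d ] M ~ diag d
diagonalise {zero}  M = (λ ()) , ≋⇒~ (ext λ ())
diagonalise {suc n} M with a , A , M~ ← split M with d , A~ ← diagonalise A =
  d′ , ~-trans M~ (~-trans (block-~ a A~) (≋⇒~ (ext block≋)))
  where
  d′ : Fin (suc n) → ℤ
  d′ zero    = a
  d′ (suc i) = d i
  block≋ : ∀ i j → block a (diag d) i j ≡ diag d′ i j
  block≋ zero    zero    = sym (ℤP.*-identityʳ a)
  block≋ zero    (suc j) = sym (ℤP.*-zeroʳ a)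
  block≋ (suc i) zero    = sym (ℤP.*-zeroʳ (d i))
  block≋ (suc i) (suc j) = refl

-- A rank bound modulo a prime

count : ∀ {n} → (Fin n → Bool) → ℕ
count {n} f = sumℕ n λ i → if f i then 1 else 0

record Enumeration {n} (f : Fin n → Bool) (m : ℕ) : Set where
  field
    index     : Fin m → Fin n
    injective : Injective _≡_ _≡_ index
    sound     : ∀ k → f (index k) ≡ true

enumeration-cons : ∀ {n m} (f : Fin (suc n) → Bool) b → f zero ≡ b → Enumeration (f ∘ suc) m →
  Enumeration f ((if b then 1 else 0) ℕ.+ m)
enumeration-cons f false f₀ E = record { index = suc ∘ index ; injective = injective ∘ suc-injective ; sound = sound }
  where open Enumeration E
enumeration-cons {n} {m} f true f₀ E = record { index = index′ ; injective = injective′ ; sound = sound′ }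
  where
  open Enumeration E
  index′ : Fin (suc m) → Fin (suc n)
  index′ zero    = zero
  index′ (suc k) = suc (index k)
  injective′ : Injective _≡_ _≡_ index′
  injective′ {zero}  {zero}  _  = refl
  injective′ {suc k} {suc l} eq = cong suc (injective (suc-injective eq))
  sound′ : ∀ k → f (index′ k) ≡ true
  sound′ zero    = f₀
  sound′ (suc k) = sound k

enumerate : ∀ {n} (f : Fin n → Bool) → Enumeration f (count f)
enumerate {zero}  f = record { index = λ () ; injective = λ { {()} } ; sound = λ () }
enumerate {suc n} f = enumeration-cons f (f zero) refl (enumerate (f ∘ suc))

count-tail-≤ : ∀ {n} (f : Fin (suc n) → Bool) → count (f ∘ suc) ≤ count f
count-tail-≤ f = ℕP.m≤n+m _ _

count-suc : ∀ {n} (f : Fin (suc n) → Bool) → f zero ≡ true → count f ≡ suc (count (f ∘ suc))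
count-suc f f₀ = cong (λ b → (if b then 1 else 0) ℕ.+ count (f ∘ suc)) f₀

infix 5 _∤ᵇ_

_∤ᵇ_ : ℤ → ℤ → Bool
p ∤ᵇ x = not (does (p ∣? x))

not-does⇒¬ : {A : Set} (a? : Dec A) → not (does a?) ≡ true → ¬ A
not-does⇒¬ (no ¬a) _ = ¬a

¬not-does⇒ : {A : Set} (a? : Dec A) → not (does a?) ≡ false → A
¬not-does⇒ (yes a) _ = a

∤ᵇ-true : ∀ p x → (p ∤ᵇ x) ≡ true → ¬ (p ∣ x)
∤ᵇ-true p x = not-does⇒¬ (p ∣? x)

∤ᵇ-false : ∀ p x → (p ∤ᵇ x) ≡ false → p ∣ x
∤ᵇ-false p x = ¬not-does⇒ (p ∣? x)

∣-sum : ∀ {n} p (f : Fin n → ℤ) → (∀ i → p ∣ f i) → p ∣ sum f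
∣-sum {zero}  p f p∣ = divides 0ℤ (sym (ℤP.*-zeroˡ p))
∣-sum {suc n} p f p∣ = ∣m∣n⇒∣m+n (p∣ zero) (∣-sum p (f ∘ suc) (p∣ ∘ suc))

sum-diff : ∀ {n} (f g : Fin n → ℤ) → sum (λ i → f i - g i) ≡ sum f - sum g
sum-diff f g = trans (∑-distrib-+ f (λ i → - g i)) (cong (_+_ (sum f)) (sum-neg g))

sum-eliminate : ∀ {n} x y (a b c : Fin n → ℤ) →
  sum (λ l → (x * a l - y * b l) * c l) ≡ x * sum (λ l → a l * c l) - y * sum (λ l → b l * c l)
sum-eliminate x y a b c = begin
  sum (λ l → (x * a l - y * b l) * c l)                          ≡⟨ sum-cong-≗ (λ l → expand x y (a l) (b l) (c l)) ⟩
  sum (λ l → x * (a l * c l) - y * (b l * c l))                  ≡⟨ sum-diff (λ l → x * (a l * c l)) (λ l → y * (b l * c l)) ⟩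
  sum (λ l → x * (a l * c l)) - sum (λ l → y * (b l * c l))      ≡⟨ cong₂ _-_ (*-distribˡ-sum x (λ l → a l * c l)) (*-distribˡ-sum y (λ l → b l * c l)) ⟨
  x * sum (λ l → a l * c l) - y * sum (λ l → b l * c l)          ∎
  where
  open ≡-Reasoning
  expand : ∀ x y a b c → (x * a - y * b) * c ≡ x * (a * c) - y * (b * c)
  expand = solve-∀

∣-diff-congˡ : ∀ {p x y} → p ∣ x - y → p ∣ y → p ∣ x
∣-diff-congˡ {p} {x} {y} p∣x-y p∣y = subst (p ∣_) (restore x y) (∣m∣n⇒∣m+n p∣x-y p∣y)
  where
  restore : ∀ x y → x - y + y ≡ x
  restore = solve-∀

∣-diff-congʳ : ∀ {p x y} → p ∣ x - y → p ∣ x → p ∣ y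
∣-diff-congʳ {p} {x} {y} p∣x-y p∣x = subst (p ∣_) (flip x y) (∣m∣n⇒∣m-n p∣x p∣x-y)
  where
  flip : ∀ x y → x - (x - y) ≡ y
  flip = solve-∀

-- Primality is stated as Euclid's lemma so that `p = 0` qualifies: divisibility by 0 is equality
-- with 0, and the bounds then concern ranks over ℚ.
module _ (p : ℤ) (prime : ∀ a b → p ∣ a * b → p ∣ a ⊎ p ∣ b) where

  ∤-* : ∀ {a b} → ¬ (p ∣ a) → ¬ (p ∣ b) → ¬ (p ∣ a * b)
  ∤-* {a} {b} p∤a p∤b p∣ab with prime a b p∣ab
  ... | inj₁ p∣a = p∤a p∣a
  ... | inj₂ p∣b = p∤b p∣b

  -- Division-free elimination on the first column of X that does not vanish modulo p.
  rank-bound : ∀ {r} s (X : Fin r → Fin s → ℤ) (Y : Fin s → Fin r → ℤ) (g : Fin s → Bool) →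
    (∀ i l → g l ≡ false → p ∣ X i l) →
    (∀ i → ¬ (p ∣ sum λ l → X i l * Y l i)) →
    (∀ i j → ¬ i ≡ j → p ∣ sum λ l → X i l * Y l j) →
    r ≤ count g
  rank-bound {zero}  s    X Y g zero-col on off = z≤n
  rank-bound {suc r} zero X Y g zero-col on off = contradiction (divides 0ℤ (sym (ℤP.*-zeroˡ p))) (on zero)
  rank-bound {suc r} (suc s) X Y g zero-col on off with any? (λ i → ¬? (p ∣? X i zero))
  ... | no none = ℕP.≤-trans
    (rank-bound s (λ i l → X i (suc l)) (λ l j → Y (suc l) j) (g ∘ suc) (λ i l → zero-col i (suc l))
      (λ i p∣S → on i (∣m∣n⇒∣m+n (p∣head i i) p∣S))
      (λ i j i≢j → ∣m+n∣m⇒∣n (off i j i≢j) (p∣head i j)))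
    (count-tail-≤ g)
    where
    p∣head : ∀ i j → p ∣ X i zero * Y zero j
    p∣head i j = ∣m⇒∣m*n (Y zero j) (decidable-stable (p ∣? X i zero) λ p∤x → none (i , p∤x))
  ... | yes (k , p∤xₖ) = subst (suc r ≤_) (sym (count-suc g g₀)) (s≤s
    (rank-bound s X′ Y′ (g ∘ suc)
      (λ i l g-false → ∣m∣n⇒∣m-n (∣n⇒∣m*n (x k) (zero-col (punchIn k i) (suc l) g-false)) (∣n⇒∣m*n (x (punchIn k i)) (zero-col k (suc l) g-false)))
      (λ i p∣ → ∤-* p∤xₖ (on (punchIn k i)) (∣-diff-congˡ {x = x k * full (punchIn k i) (punchIn k i)} (subst (p ∣_) (X′Y′ i i) p∣) (∣n⇒∣m*n (x (punchIn k i)) (off k (punchIn k i) (punchInᵢ≢i k i ∘ sym)))))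
      (λ i j i≢j → subst (p ∣_) (sym (X′Y′ i j)) (∣m∣n⇒∣m-n
        (∣n⇒∣m*n (x k) (off (punchIn k i) (punchIn k j) (i≢j ∘ punchIn-injective k i j)))
        (∣n⇒∣m*n (x (punchIn k i)) (off k (punchIn k j) (punchInᵢ≢i k j ∘ sym)))))))
    where
    open ≡-Reasoning
    x : Fin (suc r) → ℤ
    x i = X i zero
    full : Fin (suc r) → Fin (suc r) → ℤ
    full i j = sum λ l → X i l * Y l j
    tail : Fin (suc r) → Fin (suc r) → ℤ
    tail i j = sum λ l → X i (suc l) * Y (suc l) j
    g₀ : g zero ≡ true
    g₀ with g zero in eq
    ... | true  = refl
    ... | false = contradiction (zero-col k zero eq) p∤xₖ
    X′ : Fin r → Fin s → ℤ
    X′ i l = x k * X (punchIn k i) (suc l) - x (punchIn k i) * X k (suc l)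
    Y′ : Fin s → Fin r → ℤ
    Y′ l j = Y (suc l) (punchIn k j)
    cancel-head : ∀ a b y s t → a * s - b * t ≡ a * (b * y + s) - b * (a * y + t)
    cancel-head = solve-∀
    -- Cross-multiplying with the pivot row cancels every term through column zero. The subtracted
    -- product is divisible by `p`, being off the diagonal in row `k`, so modulo `p` the result is
    -- `x k` times the old product without row and column `k`, and the hypotheses persist.
    X′Y′ : ∀ i j → sum (λ l → X′ i l * Y′ l j) ≡ x k * full (punchIn k i) (punchIn k j) - x (punchIn k i) * full k (punchIn k j)
    X′Y′ i j = begin
      sum (λ l → X′ i l * Y′ l j)
        ≡⟨ sum-eliminate (x k) (x (punchIn k i)) (λ l → X (punchIn k i) (suc l)) (λ l → X k (suc l)) (λ l → Y′ l j) ⟩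
      x k * tail (punchIn k i) (punchIn k j) - x (punchIn k i) * tail k (punchIn k j)
        ≡⟨ cancel-head (x k) (x (punchIn k i)) (Y zero (punchIn k j)) (tail (punchIn k i) (punchIn k j)) (tail k (punchIn k j)) ⟩
      x k * full (punchIn k i) (punchIn k j) - x (punchIn k i) * full k (punchIn k j) ∎

-- Scaled idempotents

module ⊗-Solver {n : ℕ} = MonoidSolver (⊗-monoid n)

unsandwich : ∀ {n} (P′ P Q Q′ X : Mat n) → P′ ⊗ P ≋ δ → Q ⊗ Q′ ≋ δ → P′ ⊗ (P ⊗ X ⊗ Q) ⊗ Q′ ≋ X
unsandwich P′ P Q Q′ X P′P QQ′ = begin
  P′ ⊗ (P ⊗ X ⊗ Q) ⊗ Q′       ≈⟨ solve 5 (λ p′ p x q q′ → (p′ ⊙ ((p ⊙ x) ⊙ q)) ⊙ q′ ⊜ ((p′ ⊙ p) ⊙ x) ⊙ (q ⊙ q′)) ≋-refl P′ P X Q Q′ ⟩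
  (P′ ⊗ P) ⊗ X ⊗ (Q ⊗ Q′)     ≈⟨ ⊗-cong (⊗-congʳ X P′P) QQ′ ⟩
  δ ⊗ X ⊗ δ                   ≈⟨ ⊗-identityʳ (δ ⊗ X) ⟩
  δ ⊗ X                       ≈⟨ ⊗-identityˡ X ⟩
  X                           ∎
  where
  open ⊗-Solver using (solve; _⊜_) renaming (_⊕_ to _⊙_)
  open ≋-Reasoning

sandwich-cancel : ∀ {n} {P Q : Mat n} (X Y : Mat n) → Invertible P → Invertible Q → P ⊗ X ⊗ Q ≋ P ⊗ Y ⊗ Q → X ≋ Y
sandwich-cancel {P = P} {Q} X Y (invertible P′ _ P′P) (invertible Q′ QQ′ _) PXQ≋PYQ = begin
  X                         ≈⟨ unsandwich P′ P Q Q′ X P′P QQ′ ⟨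
  P′ ⊗ (P ⊗ X ⊗ Q) ⊗ Q′     ≈⟨ ⊗-congʳ Q′ (⊗-congˡ P′ PXQ≋PYQ) ⟩
  P′ ⊗ (P ⊗ Y ⊗ Q) ⊗ Q′     ≈⟨ unsandwich P′ P Q Q′ Y P′P QQ′ ⟩
  Y                         ∎
  where open ≋-Reasoning

·-cong : ∀ {n} c {A B : Mat n} → A ≋ B → c · A ≋ c · B
·-cong c A≋B = ext λ i j → cong (c *_) (at A≋B i j)

sandwich-· : ∀ {n} c (P X Q : Mat n) → P ⊗ (c · X) ⊗ Q ≋ c · (P ⊗ X ⊗ Q)
sandwich-· c P X Q = ≋-trans (⊗-congʳ Q (⊗-· c P X)) (·-⊗ c (P ⊗ X) Q)

count-as-sum : ∀ {n} (f : Fin n → Bool) c → sum (λ i → if f i then c else 0ℤ) ≡ c * + count f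
count-as-sum {zero}  f c = sym (ℤP.*-zeroʳ c)
count-as-sum {suc n} f c = trans (cong (_+_ (if f zero then c else 0ℤ)) (count-as-sum (f ∘ suc) c)) (step (f zero))
  where
  step : ∀ b → (if b then c else 0ℤ) + c * + count (f ∘ suc) ≡ c * + ((if b then 1 else 0) ℕ.+ count (f ∘ suc))
  step false = ℤP.+-identityˡ _
  step true  = sym (ℤP.*-suc c (+ count (f ∘ suc)))

-- In the coordinates of the diagonal form, `T ⊗ T ≋ c · T` becomes `D ⊗ S ⊗ D ≋ c · D` with
-- `S = Q ⊗ P`. The matrix `S ⊗ D` then exhibits both the trace of `T` and its rank.
module ScaledIdempotent {n} (T : Mat n) (t : Fin n → ℤ) (c : ℤ) (T~ : T ~ diag t) (TT≋cT : T ⊗ T ≋ c · T) where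
  open _~_ T~

  D S : Mat n
  D = diag t
  S = Q ⊗ P

  DSD≋cD : D ⊗ S ⊗ D ≋ c · D
  DSD≋cD = sandwich-cancel (D ⊗ S ⊗ D) (c · D) P-inv Q-inv (begin
    P ⊗ (D ⊗ (Q ⊗ P) ⊗ D) ⊗ Q
      ≈⟨ solve 3 (λ p d q → (p ⊙ ((d ⊙ (q ⊙ p)) ⊙ d)) ⊙ q ⊜ ((p ⊙ d) ⊙ q) ⊙ ((p ⊙ d) ⊙ q)) ≋-refl P D Q ⟩
    (P ⊗ D ⊗ Q) ⊗ (P ⊗ D ⊗ Q)  ≈⟨ ⊗-cong factor factor ⟨
    T ⊗ T                      ≈⟨ TT≋cT ⟩
    c · T                      ≈⟨ ·-cong c factor ⟩
    c · (P ⊗ D ⊗ Q)            ≈⟨ sandwich-· c P D Q ⟨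
    P ⊗ (c · D) ⊗ Q            ∎)
    where
    open ⊗-Solver using (solve; _⊜_) renaming (_⊕_ to _⊙_)
    open ≋-Reasoning

  -- Row `i` of `D ⊗ S ⊗ D ≋ c · D` carries the factor `t i` on both sides. What remains after
  -- cancelling is `c` times a unit vector, and such rows stay independent modulo any prime not
  -- dividing `c`.
  SD-row : ∀ i j → ¬ t i ≡ 0ℤ → (S ⊗ D) i j ≡ c * δ i j
  SD-row i j tᵢ≢0 = ℤP.*-cancelˡ-≡ (t i) _ _ {{≢-nonZero tᵢ≢0}} (begin
    t i * (S ⊗ D) i j       ≡⟨ diag-⊗ t (S ⊗ D) i j ⟨
    (D ⊗ (S ⊗ D)) i j       ≡⟨ at (⊗-assoc D S D) i j ⟨
    (D ⊗ S ⊗ D) i j         ≡⟨ at DSD≋cD i j ⟩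
    c * (t i * δ i j)       ≡⟨ swap c (t i) (δ i j) ⟩
    t i * (c * δ i j)       ∎)
    where
    open ≡-Reasoning
    swap : ∀ a b d → a * (b * d) ≡ b * (a * d)
    swap = solve-∀

  SDSD≋ : S ⊗ D ⊗ (S ⊗ D) ≋ c · (S ⊗ D)
  SDSD≋ = begin
    S ⊗ D ⊗ (S ⊗ D)     ≈⟨ solve 2 (λ s d → (s ⊙ d) ⊙ (s ⊙ d) ⊜ s ⊙ ((d ⊙ s) ⊙ d)) ≋-refl S D ⟩
    S ⊗ (D ⊗ S ⊗ D)     ≈⟨ ⊗-congˡ S DSD≋cD ⟩
    S ⊗ (c · D)         ≈⟨ ⊗-· c S D ⟩
    c · (S ⊗ D)         ∎
    where
    open ⊗-Solver using (solve; _⊜_) renaming (_⊕_ to _⊙_)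
    open ≋-Reasoning

  support : Fin n → Bool
  support i = 0ℤ ∤ᵇ t i

  support-true : ∀ i → support i ≡ true → ¬ t i ≡ 0ℤ
  support-true i eq tᵢ≡0 = ∤ᵇ-true 0ℤ (t i) eq (divides 0ℤ tᵢ≡0)

  support-false : ∀ i → support i ≡ false → t i ≡ 0ℤ
  support-false i eq = 0∣⇒≡0 (∤ᵇ-false 0ℤ (t i) eq)

  -- Cyclicity turns the trace into that of `S ⊗ D`, whose diagonal entry is `c` on the support by
  -- `SD-row` and 0 elsewhere because column `i` is a multiple of `t i`.
  trace : tr T ≡ c * + count support
  trace = begin
    tr T                                        ≡⟨ sum-cong-≗ (λ i → at factor i i) ⟩
    tr (P ⊗ D ⊗ Q)                              ≡⟨ tr-comm (P ⊗ D) Q ⟩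
    tr (Q ⊗ (P ⊗ D))                            ≡⟨ sum-cong-≗ (λ i → at (⊗-assoc Q P D) i i) ⟨
    tr (S ⊗ D)                                  ≡⟨ sum-cong-≗ (λ i → entry i (support i) refl) ⟩
    sum (λ i → if support i then c else 0ℤ)     ≡⟨ count-as-sum support c ⟩
    c * + count support                         ∎
    where
    open ≡-Reasoning
    entry : ∀ i b → support i ≡ b → (S ⊗ D) i i ≡ (if b then c else 0ℤ)
    entry i true  eq = trans (SD-row i i (support-true i eq)) (trans (cong (c *_) (δ-diag i)) (ℤP.*-identityʳ c))
    entry i false eq = trans (⊗-diag t S i i) (trans (cong (S i i *_) (support-false i eq)) (ℤP.*-zeroʳ (S i i)))

-- Comparing ranks modulo `p`

infix 4 _≋_mod_

_≋_mod_ : ∀ {n} → Mat n → Mat n → ℤ → Set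
A ≋ B mod p = ∀ i j → p ∣ A i j - B i j

mod-⊗ˡ : ∀ {n p} (X A B : Mat n) → A ≋ B mod p → X ⊗ A ≋ X ⊗ B mod p
mod-⊗ˡ {p = p} X A B A≡B i j = subst (p ∣_) (sum-diff (λ k → X i k * A k j) (λ k → X i k * B k j))
  (∣-sum p _ λ k → subst (p ∣_) (factor (X i k) (A k j) (B k j)) (∣n⇒∣m*n (X i k) (A≡B k j)))
  where
  factor : ∀ x a b → x * (a - b) ≡ x * a - x * b
  factor = solve-∀

mod-⊗ʳ : ∀ {n p} (X A B : Mat n) → A ≋ B mod p → A ⊗ X ≋ B ⊗ X mod p
mod-⊗ʳ {p = p} X A B A≡B i j = subst (p ∣_) (sum-diff (λ k → A i k * X k j) (λ k → B i k * X k j))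
  (∣-sum p _ λ k → subst (p ∣_) (factor (X k j) (A i k) (B i k)) (∣m⇒∣m*n (X k j) (A≡B i k)))
  where
  factor : ∀ x a b → (a - b) * x ≡ a * x - b * x
  factor = solve-∀

mod-resp : ∀ {n p} {A A′ B B′ : Mat n} → A ≋ A′ → B ≋ B′ → A ≋ B mod p → A′ ≋ B′ mod p
mod-resp {p = p} A≋ B≋ A≡B i j = subst₂ (λ a b → p ∣ a - b) (at A≋ i j) (at B≋ i j) (A≡B i j)

module _ (p : ℤ) (prime : ∀ a b → p ∣ a * b → p ∣ a ⊎ p ∣ b) where

  -- Restricted to the indices chosen by `f`, the product `X ⊗ Y` is diagonal modulo `p` with no
  -- vanishing diagonal entry. It factors through the columns of `X` chosen by `g`, so `rank-bound`
  -- applies.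
  support-bound : ∀ {n} (X Y : Mat n) (f g : Fin n → Bool) (a : Fin n → ℤ) →
    (∀ i l → g l ≡ false → p ∣ X i l) →
    (∀ i → f i ≡ true → ¬ (p ∣ a i)) →
    (∀ i j → f i ≡ true → p ∣ a i * δ i j - (X ⊗ Y) i j) →
    count f ≤ count g
  support-bound {n} X Y f g a zero-col p∤a XY≡a = rank-bound p prime n
    (λ i → X (index i)) (λ l j → Y l (index j)) g
    (λ i → zero-col (index i))
    (λ i p∣ → p∤a (index i) (sound i) (subst (p ∣_)
      (trans (cong (a (index i) *_) (δ-diag (index i))) (ℤP.*-identityʳ _))
      (∣-diff-congˡ {x = a (index i) * δ (index i) (index i)} (XY≡a (index i) (index i) (sound i)) p∣)))
    (λ i j i≢j → ∣-diff-congʳ {x = a (index i) * δ (index i) (index j)} (XY≡a (index i) (index j) (sound i))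
      (subst (p ∣_) (sym (trans (cong (a (index i) *_) (δ-off (i≢j ∘ injective))) (ℤP.*-zeroʳ (a (index i))))) p∣0))
    where
    open Enumeration (enumerate f)
    p∣0 : p ∣ 0ℤ
    p∣0 = divides 0ℤ (sym (ℤP.*-zeroˡ p))

  -- The two congruences say that L and T have the same column space modulo p.
  rank : ∀ {n} (L T G : Mat n) (d : Fin n → ℤ) c k s → L ~ diag d → T ⊗ T ≋ c · T →
    k · T ≋ L ⊗ G mod p → c · L ≋ T ⊗ L mod p → ¬ (p ∣ c) → ¬ (p ∣ k) → tr T ≡ c * + s →
    count (λ i → p ∤ᵇ d i) ≡ s
  rank {n} L T G d c k s L~ TT≋cT kT≡LG cL≡TL p∤c p∤k trT with t , T~ ← diagonalise T =
    trans (ℕP.≤-antisym d≤t t≤d) t≡s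
    where
    open ScaledIdempotent T t c T~ TT≋cT
    open _~_ T~ using () renaming (P to U; Q to V; factor to T-factor)
    open _~_ L~
    open Invertible P-inv renaming (inv to P′; invˡ to P′P)
    open Invertible Q-inv renaming (inv to Q′; invʳ to QQ′)
    open ⊗-Solver using (solve; _⊜_) renaming (_⊕_ to _⊙_)

    c≢0 : ¬ c ≡ 0ℤ
    c≢0 c≡0 = p∤c (divides 0ℤ (trans c≡0 (sym (ℤP.*-zeroˡ p))))

    t≡s : count support ≡ s
    t≡s = ℤP.+-injective (ℤP.*-cancelˡ-≡ c _ _ {{≢-nonZero c≢0}} (trans (sym trace) trT))

    -- Multiplying `k · T` by `V` and `U ⊗ D` gives `k · (c · (S ⊗ D))`, whose rows on the support
    -- are `k * (c * c)` times unit vectors. Modulo `p` the same product runs through `L`, hence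
    -- through `diag d`, whose columns with `p ∣ d l` vanish.
    t≤d : count support ≤ count (λ i → p ∤ᵇ d i)
    t≤d = support-bound (V ⊗ P ⊗ diag d) (Q ⊗ G ⊗ (U ⊗ D)) support _ (λ _ → k * (c * c))
      (λ i l p∣dₗ → subst (p ∣_) (sym (⊗-diag d (V ⊗ P) i l)) (∣n⇒∣m*n ((V ⊗ P) i l) (∤ᵇ-false p (d l) p∣dₗ)))
      (λ _ _ → ∤-* p prime p∤k (∤-* p prime p∤c p∤c))
      λ i j i∈ → subst (λ x → p ∣ x - _) (trans (cong (λ x → k * (c * x)) (SD-row i j (support-true i i∈))) (assoc₃ k c (δ i j)))
        (mod-resp left right (mod-⊗ʳ (U ⊗ D) (V ⊗ (k · T)) (V ⊗ (L ⊗ G)) (mod-⊗ˡ V (k · T) (L ⊗ G) kT≡LG)) i j)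
      where
      open ≋-Reasoning
      assoc₃ : ∀ k c x → k * (c * (c * x)) ≡ k * (c * c) * x
      assoc₃ = solve-∀
      left : V ⊗ (k · T) ⊗ (U ⊗ D) ≋ k · (c · (S ⊗ D))
      left = begin
        V ⊗ (k · T) ⊗ (U ⊗ D)               ≈⟨ sandwich-· k V T (U ⊗ D) ⟩
        k · (V ⊗ T ⊗ (U ⊗ D))               ≈⟨ ·-cong k (⊗-congʳ (U ⊗ D) (⊗-congˡ V T-factor)) ⟩
        k · (V ⊗ (U ⊗ D ⊗ V) ⊗ (U ⊗ D))     ≈⟨ ·-cong k (solve 3 (λ u d v → (v ⊙ ((u ⊙ d) ⊙ v)) ⊙ (u ⊙ d) ⊜ ((v ⊙ u) ⊙ d) ⊙ ((v ⊙ u) ⊙ d)) ≋-refl U D V) ⟩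
        k · (S ⊗ D ⊗ (S ⊗ D))               ≈⟨ ·-cong k SDSD≋ ⟩
        k · (c · (S ⊗ D))                   ∎
      right : V ⊗ (L ⊗ G) ⊗ (U ⊗ D) ≋ (V ⊗ P ⊗ diag d) ⊗ (Q ⊗ G ⊗ (U ⊗ D))
      right = begin
        V ⊗ (L ⊗ G) ⊗ (U ⊗ D)                       ≈⟨ ⊗-congʳ (U ⊗ D) (⊗-congˡ V (⊗-congʳ G factor)) ⟩
        V ⊗ (P ⊗ diag d ⊗ Q ⊗ G) ⊗ (U ⊗ D)          ≈⟨ solve 6 (λ v p e q g w → (v ⊙ (((p ⊙ e) ⊙ q) ⊙ g)) ⊙ w ⊜ ((v ⊙ p) ⊙ e) ⊙ ((q ⊙ g) ⊙ w)) ≋-refl V P (diag d) Q G (U ⊗ D) ⟩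
        (V ⊗ P ⊗ diag d) ⊗ (Q ⊗ G ⊗ (U ⊗ D))        ∎

    -- The converse bound: `c · diag d`, obtained from `c · L` by undoing `P` and `Q`, factors
    -- modulo `p` through `T` and so through the support of `t`.
    d≤t : count (λ i → p ∤ᵇ d i) ≤ count support
    d≤t = support-bound (P′ ⊗ U ⊗ D) (V ⊗ L ⊗ Q′) _ support (λ i → c * d i)
      (λ i l l∉ → subst (p ∣_) (sym (trans (⊗-diag t (P′ ⊗ U) i l) (trans (cong ((P′ ⊗ U) i l *_) (support-false l l∉)) (ℤP.*-zeroʳ ((P′ ⊗ U) i l))))) (divides 0ℤ (sym (ℤP.*-zeroˡ p))))
      (λ i p∤dᵢ → ∤-* p prime p∤c (∤ᵇ-true p (d i) p∤dᵢ))
      λ i j _ → subst (λ x → p ∣ x - _) (sym (ℤP.*-assoc c (d i) (δ i j))) (mod-resp left right (mod-⊗ʳ Q′ (P′ ⊗ (c · L)) (P′ ⊗ (T ⊗ L)) (mod-⊗ˡ P′ (c · L) (T ⊗ L) cL≡TL)) i j)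
      where
      open ≋-Reasoning
      left : P′ ⊗ (c · L) ⊗ Q′ ≋ c · diag d
      left = begin
        P′ ⊗ (c · L) ⊗ Q′                       ≈⟨ sandwich-· c P′ L Q′ ⟩
        c · (P′ ⊗ L ⊗ Q′)                       ≈⟨ ·-cong c (⊗-congʳ Q′ (⊗-congˡ P′ factor)) ⟩
        c · (P′ ⊗ (P ⊗ diag d ⊗ Q) ⊗ Q′)        ≈⟨ ·-cong c (unsandwich P′ P Q Q′ (diag d) P′P QQ′) ⟩
        c · diag d                              ∎
      right : P′ ⊗ (T ⊗ L) ⊗ Q′ ≋ (P′ ⊗ U ⊗ D) ⊗ (V ⊗ L ⊗ Q′)
      right = begin
        P′ ⊗ (T ⊗ L) ⊗ Q′                   ≈⟨ ⊗-congʳ Q′ (⊗-congˡ P′ (⊗-congʳ L T-factor)) ⟩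
        P′ ⊗ (U ⊗ D ⊗ V ⊗ L) ⊗ Q′           ≈⟨ solve 6 (λ p′ u d v l q′ → (p′ ⊙ (((u ⊙ d) ⊙ v) ⊙ l)) ⊙ q′ ⊜ ((p′ ⊙ u) ⊙ d) ⊙ ((v ⊙ l) ⊙ q′)) ≋-refl P′ U D V L Q′ ⟩
        (P′ ⊗ U ⊗ D) ⊗ (V ⊗ L ⊗ Q′)         ∎

-- In diagonal coordinates the hypothesis reads `D ⊗ (S ⊗ D) ≋ m · D` with `S = Q ⊗ N ⊗ P`;
-- cancelling `d i` in a diagonal entry leaves `S i i` as the quotient.
diagonal-divides : ∀ {n} (L N : Mat n) (d : Fin n → ℤ) m → L ~ diag d → L ⊗ N ⊗ L ≋ m · L → ∀ i → ¬ d i ≡ 0ℤ → d i ∣ m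
diagonal-divides {n} L N d m L~ LNL≋mL i dᵢ≢0 = divides (S i i) (sym (ℤP.*-cancelˡ-≡ (d i) _ _ {{≢-nonZero dᵢ≢0}} (begin
  d i * (S i i * d i)      ≡⟨ cong (d i *_) (⊗-diag d S i i) ⟨
  d i * (S ⊗ D) i i        ≡⟨ diag-⊗ d (S ⊗ D) i i ⟨
  (D ⊗ (S ⊗ D)) i i        ≡⟨ at DSD≋mD i i ⟩
  m * (d i * δ i i)        ≡⟨ cong (λ e → m * (d i * e)) (δ-diag i) ⟩
  m * (d i * 1ℤ)           ≡⟨ rearrange m (d i) ⟩
  d i * m                  ∎)))
  where
  open ≡-Reasoning
  open _~_ L~
  D S : Mat n
  D = diag d
  S = Q ⊗ N ⊗ P
  rearrange : ∀ m d → m * (d * 1ℤ) ≡ d * m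
  rearrange = solve-∀
  DSD≋mD : D ⊗ (S ⊗ D) ≋ m · D
  DSD≋mD = sandwich-cancel (D ⊗ (S ⊗ D)) (m · D) P-inv Q-inv (R.begin
    P ⊗ (D ⊗ (Q ⊗ N ⊗ P ⊗ D)) ⊗ Q
      R.≈⟨ ⊗-Solver.solve 4 (λ p d q n → (p ⊙ (d ⊙ (((q ⊙ n) ⊙ p) ⊙ d))) ⊙ q ⊜ (((p ⊙ d) ⊙ q) ⊙ n) ⊙ ((p ⊙ d) ⊙ q)) ≋-refl P D Q N ⟩
    (P ⊗ D ⊗ Q) ⊗ N ⊗ (P ⊗ D ⊗ Q)  R.≈⟨ ⊗-cong (⊗-congʳ N factor) factor ⟨
    L ⊗ N ⊗ L                      R.≈⟨ LNL≋mL ⟩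
    m · L                          R.≈⟨ ·-cong m factor ⟩
    m · (P ⊗ D ⊗ Q)                R.≈⟨ sandwich-· m P D Q ⟨
    P ⊗ (m · D) ⊗ Q                R.∎)
    where
    module R = ≋-Reasoning
    open ⊗-Solver using (_⊜_) renaming (_⊕_ to _⊙_)

-- The algebra spanned by I, L and J

J : ∀ {n} → Mat n
J _ _ = 1ℤ

module Combination {n} (L : Mat n) where

  -- The relations below close these combinations under multiplication, so matrix identities reduce
  -- to ring identities in the entries of `δ` and `L`. The factor `1ℤ` is the entry of `J`: it makes
  -- `comb α β γ` unfold to `α · δ ⊕ β · L ⊕ γ · J`.
  comb : ℤ → ℤ → ℤ → Mat n
  comb α β γ i j = α * δ i j + β * L i j + γ * 1ℤ

  comb-⊗ : ∀ α β γ X i j → (comb α β γ ⊗ X) i j ≡ α * X i j + β * (L ⊗ X) i j + γ * (J ⊗ X) i j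
  comb-⊗ α β γ X i j = begin
    ((α · δ ⊕ β · L ⊕ γ · J) ⊗ X) i j                             ≡⟨ at (⊗-distribʳ X (α · δ ⊕ β · L) (γ · J)) i j ⟩
    ((α · δ ⊕ β · L) ⊗ X) i j + (γ · J ⊗ X) i j                   ≡⟨ cong₂ _+_ (at (⊗-distribʳ X (α · δ) (β · L)) i j) (at (·-⊗ γ J X) i j) ⟩
    (α · δ ⊗ X) i j + (β · L ⊗ X) i j + γ * (J ⊗ X) i j           ≡⟨ cong (_+ γ * (J ⊗ X) i j) (cong₂ _+_ (at (·-⊗ α δ X) i j) (at (·-⊗ β L X) i j)) ⟩
    α * (δ ⊗ X) i j + β * (L ⊗ X) i j + γ * (J ⊗ X) i j           ≡⟨ cong (λ x → α * x + β * (L ⊗ X) i j + γ * (J ⊗ X) i j) (at (⊗-identityˡ X) i j) ⟩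
    α * X i j + β * (L ⊗ X) i j + γ * (J ⊗ X) i j                 ∎
    where open ≡-Reasoning

  ⊗-comb : ∀ α β γ X i j → (X ⊗ comb α β γ) i j ≡ α * X i j + β * (X ⊗ L) i j + γ * (X ⊗ J) i j
  ⊗-comb α β γ X i j = begin
    (X ⊗ (α · δ ⊕ β · L ⊕ γ · J)) i j                             ≡⟨ at (⊗-distribˡ X (α · δ ⊕ β · L) (γ · J)) i j ⟩
    (X ⊗ (α · δ ⊕ β · L)) i j + (X ⊗ γ · J) i j                   ≡⟨ cong₂ _+_ (at (⊗-distribˡ X (α · δ) (β · L)) i j) (at (⊗-· γ X J) i j) ⟩
    (X ⊗ α · δ) i j + (X ⊗ β · L) i j + γ * (X ⊗ J) i j           ≡⟨ cong (_+ γ * (X ⊗ J) i j) (cong₂ _+_ (at (⊗-· α X δ) i j) (at (⊗-· β X L) i j)) ⟩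
    α * (X ⊗ δ) i j + β * (X ⊗ L) i j + γ * (X ⊗ J) i j           ≡⟨ cong (λ x → α * x + β * (X ⊗ L) i j + γ * (X ⊗ J) i j) (at (⊗-identityʳ X) i j) ⟩
    α * X i j + β * (X ⊗ L) i j + γ * (X ⊗ J) i j                 ∎
    where open ≡-Reasoning

-- `ℓ` and `μ` are the nonzero eigenvalues, roots of the quadratic in `square`. Its constant term is
-- also the number of vertices, so one product governs both `L ⊗ L` and `J ⊗ J`. Naming the roots in
-- order allows exchanging them between the two primes.
record LaplacianRelations {n} (L : Mat n) (ℓ μ : ℤ) : Set where
  open Combination L
  field
    size    : + n ≡ ℓ * μ
    row-sum : ∀ i → sum (λ k → L i k) ≡ 0ℤ
    col-sum : ∀ j → sum (λ k → L k j) ≡ 0ℤ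
    square  : ∀ i j → (L ⊗ L) i j ≡ comb (- (ℓ * μ)) (ℓ + μ) 1ℤ i j

module _ {n} (L : Mat n) (ℓ μ : ℤ) (relations : LaplacianRelations L ℓ μ) where
  open LaplacianRelations relations
  open Combination L
  open ≡-Reasoning

  private
    m = ℓ * μ

  LJ : ∀ i j → (L ⊗ J) i j ≡ 0ℤ
  LJ i j = trans (sum-cong-≗ λ k → ℤP.*-identityʳ (L i k)) (row-sum i)

  JL : ∀ i j → (J ⊗ L) i j ≡ 0ℤ
  JL i j = trans (sum-cong-≗ λ k → ℤP.*-identityˡ (L k j)) (col-sum j)

  JJ : ∀ (i j : Fin n) → (J ⊗ J) i j ≡ ℓ * μ
  JJ i j = trans (sum-const n (1ℤ * 1ℤ)) (trans (ℤP.*-identityʳ (+ n)) size)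

  L⊗comb : ∀ α β γ i j → (L ⊗ comb α β γ) i j ≡ comb (- (β * m)) (α + β * (ℓ + μ)) β i j
  L⊗comb α β γ i j = begin
    (L ⊗ comb α β γ) i j                                   ≡⟨ ⊗-comb α β γ L i j ⟩
    α * L i j + β * (L ⊗ L) i j + γ * (L ⊗ J) i j          ≡⟨ cong₂ (λ x y → α * L i j + β * x + γ * y) (square i j) (LJ i j) ⟩
    α * L i j + β * comb (- m) (ℓ + μ) 1ℤ i j + γ * 0ℤ     ≡⟨ collect α β γ m (ℓ + μ) (δ i j) (L i j) ⟩
    comb (- (β * m)) (α + β * (ℓ + μ)) β i j               ∎
    where
    collect : ∀ α β γ m s d l → α * l + β * (- m * d + s * l + 1ℤ * 1ℤ) + γ * 0ℤ ≡ - (β * m) * d + (α + β * s) * l + β * 1ℤ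
    collect = solve-∀

  J⊗comb : ∀ α β γ i j → (J ⊗ comb α β γ) i j ≡ α + γ * m
  J⊗comb α β γ i j = begin
    (J ⊗ comb α β γ) i j                             ≡⟨ ⊗-comb α β γ J i j ⟩
    α * 1ℤ + β * (J ⊗ L) i j + γ * (J ⊗ J) i j       ≡⟨ cong₂ (λ x y → α * 1ℤ + β * x + γ * y) (JL i j) (JJ i j) ⟩
    α * 1ℤ + β * 0ℤ + γ * m                          ≡⟨ collect α β γ m ⟩
    α + γ * m                                        ∎
    where
    collect : ∀ α β γ m → α * 1ℤ + β * 0ℤ + γ * m ≡ α + γ * m
    collect = solve-∀

  comb⊗comb : ∀ α β γ α′ β′ γ′ i j → (comb α β γ ⊗ comb α′ β′ γ′) i j ≡
    comb (α * α′ - β * β′ * m) (α * β′ + β * α′ + β * β′ * (ℓ + μ)) (α * γ′ + β * β′ + γ * (α′ + γ′ * m)) i j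
  comb⊗comb α β γ α′ β′ γ′ i j = begin
    (comb α β γ ⊗ comb α′ β′ γ′) i j
      ≡⟨ comb-⊗ α β γ (comb α′ β′ γ′) i j ⟩
    α * comb α′ β′ γ′ i j + β * (L ⊗ comb α′ β′ γ′) i j + γ * (J ⊗ comb α′ β′ γ′) i j
      ≡⟨ cong₂ (λ x y → α * comb α′ β′ γ′ i j + β * x + γ * y) (L⊗comb α′ β′ γ′ i j) (J⊗comb α′ β′ γ′ i j) ⟩
    α * comb α′ β′ γ′ i j + β * comb (- (β′ * m)) (α′ + β′ * (ℓ + μ)) β′ i j + γ * (α′ + γ′ * m)
      ≡⟨ collect α β γ α′ β′ γ′ m (ℓ + μ) (δ i j) (L i j) ⟩
    comb (α * α′ - β * β′ * m) (α * β′ + β * α′ + β * β′ * (ℓ + μ)) (α * γ′ + β * β′ + γ * (α′ + γ′ * m)) i j ∎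
    where
    collect : ∀ α β γ α′ β′ γ′ m s d l →
      α * (α′ * d + β′ * l + γ′ * 1ℤ) + β * (- (β′ * m) * d + (α′ + β′ * s) * l + β′ * 1ℤ) + γ * (α′ + γ′ * m) ≡
      (α * α′ - β * β′ * m) * d + (α * β′ + β * α′ + β * β′ * s) * l + (α * γ′ + β * β′ + γ * (α′ + γ′ * m)) * 1ℤ
    collect = solve-∀

  comb-row-sum : ∀ α β γ i → sum (comb α β γ i) ≡ α + γ * m
  comb-row-sum α β γ i = begin
    sum (comb α β γ i)                               ≡⟨ sum-cong-≗ (λ k → ℤP.*-identityʳ (comb α β γ i k)) ⟨
    (comb α β γ ⊗ J) i i                             ≡⟨ comb-⊗ α β γ J i i ⟩
    α * 1ℤ + β * (L ⊗ J) i i + γ * (J ⊗ J) i i       ≡⟨ cong₂ (λ x y → α * 1ℤ + β * x + γ * y) (LJ i i) (JJ i i) ⟩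
    α * 1ℤ + β * 0ℤ + γ * m                          ≡⟨ collect α β γ m ⟩
    α + γ * m                                        ∎
    where
    collect : ∀ α β γ m → α * 1ℤ + β * 0ℤ + γ * m ≡ α + γ * m
    collect = solve-∀

  tr-comb : ∀ α β γ → tr (comb α β γ) ≡ α * m + β * tr L + γ * m
  tr-comb α β γ = begin
    sum (λ i → α * δ i i + β * L i i + γ * 1ℤ)
      ≡⟨ sum-cong-≗ (λ i → trans (cong (λ e → α * e + β * L i i + γ * 1ℤ) (δ-diag i)) (reorder α β γ (L i i))) ⟩
    sum (λ i → β * L i i + (α + γ))
      ≡⟨ ∑-distrib-+ (λ i → β * L i i) (λ _ → α + γ) ⟩
    sum (λ i → β * L i i) + sum {n} (λ _ → α + γ)
      ≡⟨ cong₂ _+_ (sym (*-distribˡ-sum β (λ i → L i i))) (trans (sum-const n (α + γ)) (cong (_* (α + γ)) size)) ⟩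
    β * tr L + m * (α + γ)
      ≡⟨ collect α β γ m (tr L) ⟩
    α * m + β * tr L + γ * m ∎
    where
    reorder : ∀ α β γ l → α * 1ℤ + β * l + γ * 1ℤ ≡ β * l + (α + γ)
    reorder = solve-∀
    collect : ∀ α β γ m t → β * t + m * (α + γ) ≡ α * m + β * t + γ * m
    collect = solve-∀

  comb⊗L : ∀ α β γ i j → (comb α β γ ⊗ L) i j ≡ comb (- (β * m)) (α + β * (ℓ + μ)) β i j
  comb⊗L α β γ i j = begin
    (comb α β γ ⊗ L) i j                             ≡⟨ comb-⊗ α β γ L i j ⟩
    α * L i j + β * (L ⊗ L) i j + γ * (J ⊗ L) i j    ≡⟨ cong₂ (λ x y → α * L i j + β * x + γ * y) (square i j) (JL i j) ⟩
    α * L i j + β * comb (- m) (ℓ + μ) 1ℤ i j + γ * 0ℤ     ≡⟨ collect α β γ m (ℓ + μ) (δ i j) (L i j) ⟩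
    comb (- (β * m)) (α + β * (ℓ + μ)) β i j               ∎
    where
    collect : ∀ α β γ m s d l → α * l + β * (- m * d + s * l + 1ℤ * 1ℤ) + γ * 0ℤ ≡ - (β * m) * d + (α + β * s) * l + β * 1ℤ
    collect = solve-∀

  -- `L` times `(ℓ + μ) I − L` is `m I − J`, and the last factor `L` annihilates `J`.
  inner-inverse : L ⊗ comb (ℓ + μ) (- 1ℤ) 0ℤ ⊗ L ≋ m · L
  inner-inverse = ext λ i j → begin
    (L ⊗ comb s (- 1ℤ) 0ℤ ⊗ L) i j
      ≡⟨ at (⊗-congʳ L (ext (L⊗comb s (- 1ℤ) 0ℤ))) i j ⟩
    (comb (- (- 1ℤ * m)) (s + - 1ℤ * s) (- 1ℤ) ⊗ L) i j
      ≡⟨ comb⊗L (- (- 1ℤ * m)) (s + - 1ℤ * s) (- 1ℤ) i j ⟩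
    comb (- ((s + - 1ℤ * s) * m)) (- (- 1ℤ * m) + (s + - 1ℤ * s) * s) (s + - 1ℤ * s) i j
      ≡⟨ collect s m (δ i j) (L i j) ⟩
    m * L i j ∎
    where
    s = ℓ + μ
    collect : ∀ s m d l → - ((s + - 1ℤ * s) * m) * d + (- (- 1ℤ * m) + (s + - 1ℤ * s) * s) * l + (s + - 1ℤ * s) * 1ℤ ≡ m * l
    collect = solve-∀

  L-diagonal-divides : ∀ d → L ~ diag d → ∀ i → ¬ d i ≡ 0ℤ → d i ∣ m
  L-diagonal-divides d L~ = diagonal-divides L (comb (ℓ + μ) (- 1ℤ) 0ℤ) d m L~ inner-inverse

  private
    ≡⇒∣- : ∀ {p x y} → x ≡ y → p ∣ x - y
    ≡⇒∣- {p} {x} refl = divides 0ℤ (trans (ℤP.+-inverseʳ x) (sym (ℤP.*-zeroˡ p)))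

  -- The case `p = 0` of `rank`, where congruences are equations. `T = m I − J` is `m` times the
  -- projection onto the vectors of coordinate sum zero, and equals `L` times `(ℓ + μ) I − L`.
  rank-ℚ : ∀ d r → L ~ diag d → ¬ m ≡ 0ℤ → m * m - m ≡ m * + r → count (λ i → 0ℤ ∤ᵇ d i) ≡ r
  rank-ℚ d r L~ m≢0 trace = rank 0ℤ 0-prime L T (comb s (- 1ℤ) 0ℤ) d m 1ℤ r L~ (ext TT)
    (λ i j → ≡⇒∣- (trans (simplify₁ s m (δ i j) (L i j)) (sym (L⊗comb s (- 1ℤ) 0ℤ i j))))
    (λ i j → ≡⇒∣- (trans (simplify₂ m s (δ i j) (L i j)) (sym (comb⊗L m 0ℤ (- 1ℤ) i j))))
    (λ 0∣m → m≢0 (0∣⇒≡0 0∣m)) (λ 0∣1 → contradiction (0∣⇒≡0 0∣1) λ ())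
    (trans (tr-comb m 0ℤ (- 1ℤ)) (trans (simplify₃ m (tr L)) trace))
    where
    s = ℓ + μ
    T : Mat n
    T = comb m 0ℤ (- 1ℤ)
    0-prime : ∀ a b → 0ℤ ∣ a * b → 0ℤ ∣ a ⊎ 0ℤ ∣ b
    0-prime a b 0∣ab with ℤP.i*j≡0⇒i≡0∨j≡0 a (0∣⇒≡0 0∣ab)
    ... | inj₁ a≡0 = inj₁ (divides 0ℤ a≡0)
    ... | inj₂ b≡0 = inj₂ (divides 0ℤ b≡0)
    collect : ∀ m s d l → (m * m - 0ℤ * 0ℤ * m) * d + (m * 0ℤ + 0ℤ * m + 0ℤ * 0ℤ * s) * l + (m * - 1ℤ + 0ℤ * 0ℤ + - 1ℤ * (m + - 1ℤ * m)) * 1ℤ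
      ≡ m * (m * d + 0ℤ * l + - 1ℤ * 1ℤ)
    collect = solve-∀
    TT : ∀ i j → (T ⊗ T) i j ≡ m * T i j
    TT i j = trans (comb⊗comb m 0ℤ (- 1ℤ) m 0ℤ (- 1ℤ) i j) (collect m s (δ i j) (L i j))
    simplify₁ : ∀ s m d l → 1ℤ * (m * d + 0ℤ * l + - 1ℤ * 1ℤ) ≡ - (- 1ℤ * m) * d + (s + - 1ℤ * s) * l + - 1ℤ * 1ℤ
    simplify₁ = solve-∀
    simplify₂ : ∀ m s d l → m * l ≡ - (0ℤ * m) * d + (m + 0ℤ * s) * l + 0ℤ * 1ℤ
    simplify₂ = solve-∀
    simplify₃ : ∀ m t → m * m + 0ℤ * t + - 1ℤ * m ≡ m * m - m
    simplify₃ = solve-∀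

  -- Here `p` divides `ℓ * μ` but not `ℓ`, so `μ` vanishes modulo `p`. In the trace hypothesis the
  -- first three summands are the trace of `E`; the parenthesis equals `ℓ * (ℓ - μ)` and accounts
  -- for one extra dimension. The vertex `u` selects a row of `F`.
  rank-mod : ∀ p → (∀ a b → p ∣ a * b → p ∣ a ⊎ p ∣ b) → p ∣ m → ¬ (p ∣ ℓ) → ¬ (p ∣ ℓ * (ℓ - μ)) →
    Fin n → ∀ d r → L ~ diag d →
    - m * m + ℓ * tr L + 1ℤ * m + (ℓ * ℓ + - 1ℤ * m) ≡ ℓ * (ℓ - μ) * + r → count (λ i → p ∤ᵇ d i) ≡ r
  rank-mod p prime p∣m p∤ℓ p∤c u d r L~ trace = rank p prime L T G d c ℓ r L~ (ext TT) ℓT≡LG cL≡TL p∤c p∤ℓ trT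
    where
    c s : ℤ
    c = ℓ * (ℓ - μ)
    s = ℓ + μ
    -- E and F are c times the projections onto the ℓ-eigenspace and its complement.  Modulo p the image of L is
    -- larger than that of E by the all-ones vector e, so T adds the rank-one idempotent e (e_uᵀ F).
    E F T G H : Mat n
    E = comb (- m) ℓ 1ℤ
    F = comb (ℓ * ℓ) (- ℓ) (- 1ℤ)
    T i j = E i j + F u j
    H i j = F i u * F u j
    G = comb (ℓ * - μ) ℓ 0ℤ ⊕ (- 1ℤ) · H

    trT : tr T ≡ c * + r
    trT = begin
      tr T                                                ≡⟨ ∑-distrib-+ (λ i → E i i) (F u) ⟩
      tr E + sum (F u)                                    ≡⟨ cong₂ _+_ (tr-comb (- m) ℓ 1ℤ) (comb-row-sum (ℓ * ℓ) (- ℓ) (- 1ℤ) u) ⟩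
      - m * m + ℓ * tr L + 1ℤ * m + (ℓ * ℓ + - 1ℤ * m)    ≡⟨ trace ⟩
      c * + r                                             ∎

    EE : ∀ i j → (E ⊗ E) i j ≡ c * E i j
    EE i j = trans (comb⊗comb (- m) ℓ 1ℤ (- m) ℓ 1ℤ i j) (collect ℓ μ (δ i j) (L i j))
      where
      collect : ∀ ℓ μ d l → (- (ℓ * μ) * - (ℓ * μ) - ℓ * ℓ * (ℓ * μ)) * d + (- (ℓ * μ) * ℓ + ℓ * - (ℓ * μ) + ℓ * ℓ * (ℓ + μ)) * l + (- (ℓ * μ) * 1ℤ + ℓ * ℓ + 1ℤ * (- (ℓ * μ) + 1ℤ * (ℓ * μ))) * 1ℤ
        ≡ ℓ * (ℓ - μ) * (- (ℓ * μ) * d + ℓ * l + 1ℤ * 1ℤ)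
      collect = solve-∀

    FE : ∀ i j → (F ⊗ E) i j ≡ 0ℤ
    FE i j = trans (comb⊗comb (ℓ * ℓ) (- ℓ) (- 1ℤ) (- m) ℓ 1ℤ i j) (collect ℓ μ (δ i j) (L i j))
      where
      collect : ∀ ℓ μ d l → (ℓ * ℓ * - (ℓ * μ) - - ℓ * ℓ * (ℓ * μ)) * d + (ℓ * ℓ * ℓ + - ℓ * - (ℓ * μ) + - ℓ * ℓ * (ℓ + μ)) * l + (ℓ * ℓ * 1ℤ + - ℓ * ℓ + - 1ℤ * (- (ℓ * μ) + 1ℤ * (ℓ * μ))) * 1ℤ ≡ 0ℤ
      collect = solve-∀

    E-row-sum : ∀ i → sum (E i) ≡ 0ℤ
    E-row-sum i = trans (comb-row-sum (- m) ℓ 1ℤ i) (collect m)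
      where
      collect : ∀ m → - m + 1ℤ * m ≡ 0ℤ
      collect = solve-∀

    F-row-sum : sum (F u) ≡ c
    F-row-sum = trans (comb-row-sum (ℓ * ℓ) (- ℓ) (- 1ℤ) u) (collect ℓ μ)
      where
      collect : ∀ ℓ μ → ℓ * ℓ + - 1ℤ * (ℓ * μ) ≡ ℓ * (ℓ - μ)
      collect = solve-∀

    TX : ∀ X i j → (T ⊗ X) i j ≡ (E ⊗ X) i j + (F ⊗ X) u j
    TX X i j = trans (sum-cong-≗ λ k → ℤP.*-distribʳ-+ (X k j) (E i k) (F u k)) (∑-distrib-+ (λ k → E i k * X k j) (λ k → F u k * X k j))

    XT : ∀ (X : Mat n) i j → (X ⊗ T) i j ≡ (X ⊗ E) i j + sum (X i) * F u j
    XT X i j = trans (sum-cong-≗ λ k → ℤP.*-distribˡ-+ (X i k) (E k j) (F u j))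
      (trans (∑-distrib-+ (λ k → X i k * E k j) (λ k → X i k * F u j)) (cong (_+_ ((X ⊗ E) i j)) (sym (*-distribʳ-sum (F u j) (X i)))))

    -- With `e` the all-ones vector and `f` row `u` of `F`, `T` is `E + e f`. Both cross terms
    -- vanish, by `E e = 0` and `f E = 0`, while `f e = c` makes `e f` a scaled idempotent like `E`.
    TT : ∀ i j → (T ⊗ T) i j ≡ c * T i j
    TT i j = begin
      (T ⊗ T) i j                                                                ≡⟨ TX T i j ⟩
      (E ⊗ T) i j + (F ⊗ T) u j                                                  ≡⟨ cong₂ _+_ (XT E i j) (XT F u j) ⟩
      (E ⊗ E) i j + sum (E i) * F u j + ((F ⊗ E) u j + sum (F u) * F u j)        ≡⟨ cong₂ _+_ (cong₂ (λ x y → x + y * F u j) (EE i j) (E-row-sum i)) (cong₂ (λ x y → x + y * F u j) (FE u j) F-row-sum) ⟩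
      c * E i j + 0ℤ * F u j + (0ℤ + c * F u j)                                  ≡⟨ collect c (E i j) (F u j) ⟩
      c * T i j                                                                  ∎
      where
      collect : ∀ c e f → c * e + 0ℤ * f + (0ℤ + c * f) ≡ c * (e + f)
      collect = solve-∀

    -- The two summands of `G` produce the two of `T`: `L ⊗ comb (ℓ * - μ) ℓ 0ℤ` is exactly `ℓ · E`,
    -- while `L ⊗ F` is `- ℓ · J` modulo `m`, so `- 1ℤ · H` yields `ℓ` times the rank-one part.
    ℓT≡LG : ℓ · T ≋ L ⊗ G mod p
    ℓT≡LG i j = subst (p ∣_) (sym difference) (∣m⇒∣m*n ((ℓ * δ i u - L i u) * F u j) p∣m)
      where
      collect : ∀ ℓ μ d l d′ l′ f →
        ℓ * (- (ℓ * μ) * d + ℓ * l + 1ℤ * 1ℤ + f)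
        - (- (ℓ * (ℓ * μ)) * d + (ℓ * - μ + ℓ * (ℓ + μ)) * l + ℓ * 1ℤ
           + - 1ℤ * ((- (- ℓ * (ℓ * μ)) * d′ + (ℓ * ℓ + - ℓ * (ℓ + μ)) * l′ + - ℓ * 1ℤ) * f))
        ≡ ℓ * μ * ((ℓ * d′ - l′) * f)
      collect = solve-∀
      LH : (L ⊗ H) i j ≡ (L ⊗ F) i u * F u j
      LH = trans (sum-cong-≗ λ k → sym (ℤP.*-assoc (L i k) (F k u) (F u j))) (sym (*-distribʳ-sum (F u j) (λ k → L i k * F k u)))
      LG : (L ⊗ G) i j ≡ comb (- (ℓ * m)) (ℓ * - μ + ℓ * s) ℓ i j + - 1ℤ * (comb (- (- ℓ * m)) (ℓ * ℓ + - ℓ * s) (- ℓ) i u * F u j)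
      LG = begin
        (L ⊗ G) i j                                                        ≡⟨ at (⊗-distribˡ L (comb (ℓ * - μ) ℓ 0ℤ) ((- 1ℤ) · H)) i j ⟩
        (L ⊗ comb (ℓ * - μ) ℓ 0ℤ) i j + (L ⊗ (- 1ℤ) · H) i j                 ≡⟨ cong₂ _+_ (L⊗comb (ℓ * - μ) ℓ 0ℤ i j) (at (⊗-· (- 1ℤ) L H) i j) ⟩
        comb (- (ℓ * m)) (ℓ * - μ + ℓ * s) ℓ i j + - 1ℤ * (L ⊗ H) i j      ≡⟨ cong (λ x → comb (- (ℓ * m)) (ℓ * - μ + ℓ * s) ℓ i j + - 1ℤ * x) (trans LH (cong (_* F u j) (L⊗comb (ℓ * ℓ) (- ℓ) (- 1ℤ) i u))) ⟩
        comb (- (ℓ * m)) (ℓ * - μ + ℓ * s) ℓ i j + - 1ℤ * (comb (- (- ℓ * m)) (ℓ * ℓ + - ℓ * s) (- ℓ) i u * F u j) ∎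
      difference : ℓ * T i j - (L ⊗ G) i j ≡ m * ((ℓ * δ i u - L i u) * F u j)
      difference = trans (cong (λ x → ℓ * T i j - x) LG) (collect ℓ μ (δ i j) (L i j) (δ i u) (L i u) (F u j))

    -- `E ⊗ L` is `ℓ * ℓ` times `L` plus `ℓ · J` modulo `m`. Row `u` of `F ⊗ L` is constantly `- ℓ`
    -- modulo `m` and removes the `J` term; finally `c` is congruent to `ℓ * ℓ`.
    cL≡TL : c · L ≋ T ⊗ L mod p
    cL≡TL i j = subst (p ∣_) (sym difference) (∣m⇒∣m*n (ℓ * δ i j - L i j - (ℓ * δ u j - L u j)) p∣m)
      where
      collect : ∀ ℓ μ d l d′ l′ →
        ℓ * (ℓ - μ) * l
        - (- (ℓ * (ℓ * μ)) * d + (- (ℓ * μ) + ℓ * (ℓ + μ)) * l + ℓ * 1ℤ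
           + (- (- ℓ * (ℓ * μ)) * d′ + (ℓ * ℓ + - ℓ * (ℓ + μ)) * l′ + - ℓ * 1ℤ))
        ≡ ℓ * μ * (ℓ * d - l - (ℓ * d′ - l′))
      collect = solve-∀
      difference : c * L i j - (T ⊗ L) i j ≡ m * (ℓ * δ i j - L i j - (ℓ * δ u j - L u j))
      difference = trans (cong (λ x → c * L i j - x) (trans (TX L i j) (cong₂ _+_ (comb⊗L (- m) ℓ 1ℤ i j) (comb⊗L (ℓ * ℓ) (- ℓ) (- 1ℤ) u j))))
        (collect ℓ μ (δ i j) (L i j) (δ u j) (L u j))

-- Moore graphs of diameter two

sumℤ≡sum : ∀ {n} (f : Fin n → ℤ) → sumℤ n f ≡ sum f
sumℤ≡sum {zero}  f = refl
sumℤ≡sum {suc n} f = cong (_+_ (f zero)) (sumℤ≡sum (f ∘ suc))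

+sumℕ≡sum : ∀ {n} (f : Fin n → ℕ) → + sumℕ n f ≡ sum (λ i → + f i)
+sumℕ≡sum {zero}  f = refl
+sumℕ≡sum {suc n} f = cong (_+_ (+ f zero)) (+sumℕ≡sum (f ∘ suc))

indicator : Bool → ℤ
indicator b = if b then 1ℤ else 0ℤ

module MooreGraph {n} (Γ : Graph n) (k : ℕ) (moore : IsMoore Γ 2 k) where
  open Graph Γ

  private
    regular  = proj₁ moore
    near     = proj₁ (proj₁ (proj₂ moore))
    no-cycle = proj₂ (proj₂ (proj₂ moore))

  adj-sym : ∀ {i j} → Adj Γ i j → Adj Γ j i
  adj-sym {i} {j} ij = trans (symmetric j i) ij

  adj-≢ : ∀ {i j} → Adj Γ i j → ¬ i ≡ j
  adj-≢ {i} ij refl = contradiction (trans (sym ij) (loopless i)) λ ()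

  no-triangle : ∀ {i j l} → Adj Γ i j → Adj Γ j l → ¬ Adj Γ l i
  no-triangle {i} {j} {l} ij jl li = no-cycle 3 (s≤s (s≤s (s≤s z≤n))) (s≤s (s≤s (s≤s (s≤s z≤n)))) (c , c-injective , edges , li)
    where
    c : Fin 3 → Fin n
    c 0F = i
    c 1F = j
    c 2F = l
    c-injective : Injective _≡_ _≡_ c
    c-injective {0F} {0F} _  = refl
    c-injective {0F} {1F} eq = contradiction eq (adj-≢ ij)
    c-injective {0F} {2F} eq = contradiction (sym eq) (adj-≢ li)
    c-injective {1F} {0F} eq = contradiction (sym eq) (adj-≢ ij)
    c-injective {1F} {1F} _  = refl
    c-injective {1F} {2F} eq = contradiction eq (adj-≢ jl)
    c-injective {2F} {0F} eq = contradiction eq (adj-≢ li)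
    c-injective {2F} {1F} eq = contradiction (sym eq) (adj-≢ jl)
    c-injective {2F} {2F} _  = refl
    edges : ∀ i → Adj Γ (c (inject₁ i)) (c (suc i))
    edges 0F = ij
    edges 1F = jl

  -- Two different common neighbours would close the 4-cycle `i`, `l`, `j`, `l′`, which girth 5
  -- forbids.
  unique-common-neighbour : ∀ {i j l l′} → ¬ i ≡ j → Adj Γ i l → Adj Γ l j → Adj Γ i l′ → Adj Γ l′ j → l ≡ l′
  unique-common-neighbour {i} {j} {l} {l′} i≢j il lj il′ l′j with l ≟ l′
  ... | yes l≡l′ = l≡l′
  ... | no  l≢l′ = ⊥-elim (no-cycle 4 (s≤s (s≤s (s≤s z≤n))) (s≤s (s≤s (s≤s (s≤s (s≤s z≤n))))) (c , c-injective , edges , adj-sym il′))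
    where
    c : Fin 4 → Fin n
    c 0F = i
    c 1F = l
    c 2F = j
    c 3F = l′
    c-injective : Injective _≡_ _≡_ c
    c-injective {0F} {0F} _  = refl
    c-injective {0F} {1F} eq = contradiction eq (adj-≢ il)
    c-injective {0F} {2F} eq = contradiction eq i≢j
    c-injective {0F} {3F} eq = contradiction eq (adj-≢ il′)
    c-injective {1F} {0F} eq = contradiction (sym eq) (adj-≢ il)
    c-injective {1F} {1F} _  = refl
    c-injective {1F} {2F} eq = contradiction eq (adj-≢ lj)
    c-injective {1F} {3F} eq = contradiction eq l≢l′
    c-injective {2F} {0F} eq = contradiction (sym eq) i≢j
    c-injective {2F} {1F} eq = contradiction (sym eq) (adj-≢ lj)
    c-injective {2F} {2F} _  = refl
    c-injective {2F} {3F} eq = contradiction (sym eq) (adj-≢ l′j)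
    c-injective {3F} {0F} eq = contradiction (sym eq) (adj-≢ il′)
    c-injective {3F} {1F} eq = contradiction (sym eq) l≢l′
    c-injective {3F} {2F} eq = contradiction eq (adj-≢ l′j)
    c-injective {3F} {3F} _  = refl
    edges : ∀ i → Adj Γ (c (inject₁ i)) (c (suc i))
    edges 0F = il
    edges 1F = lj
    edges 2F = adj-sym l′j

  -- A walk of length at most 2 exists; length 0 contradicts distinctness and length 1 contradicts
  -- nonadjacency.
  common-neighbour : ∀ {i j} → ¬ i ≡ j → ¬ Adj Γ i j → ∃[ l ] Adj Γ i l × Adj Γ l j
  common-neighbour {i} {j} i≢j i≁j with near i j
  ... | 0 , _ , w , w₀ , w₁ , _ = contradiction (trans (sym w₀) w₁) i≢j
  ... | 1 , _ , w , w₀ , w₁ , step = contradiction (subst₂ (Adj Γ) w₀ w₁ (step 0F)) i≁j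
  ... | 2 , _ , w , w₀ , w₂ , step = w 1F , subst (λ x → Adj Γ x (w 1F)) w₀ (step 0F) , subst (Adj Γ (w 1F)) w₂ (step 1F)
  ... | suc (suc (suc _)) , s≤s (s≤s ()) , _

  A : Mat n
  A i j = indicator (adj i j)

  A-sym : ∀ i j → A i j ≡ A j i
  A-sym i j = cong indicator (symmetric i j)

  A-adj : ∀ {i j} → Adj Γ i j → A i j ≡ 1ℤ
  A-adj = cong indicator

  A-row-sum : ∀ i → sum (A i) ≡ + k
  A-row-sum i = trans (sum-cong-≗ λ j → push (adj i j)) (trans (sym (+sumℕ≡sum λ j → if adj i j then 1 else 0)) (cong +_ (regular i)))
    where
    push : ∀ b → indicator b ≡ + (if b then 1 else 0)
    push true  = refl
    push false = refl

  path-vanishes : ∀ i l j → ¬ (Adj Γ i l × Adj Γ l j) → A i l * A l j ≡ 0ℤ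
  path-vanishes i l j no-path with adj i l | adj l j
  ... | false | b     = ℤP.*-zeroˡ (indicator b)
  ... | true  | false = refl
  ... | true  | true  = contradiction (refl , refl) no-path

  A²-diagonal : ∀ i → (A ⊗ A) i i ≡ + k
  A²-diagonal i = trans (sum-cong-≗ λ l → trans (cong (A i l *_) (A-sym l i)) (idem (adj i l))) (A-row-sum i)
    where
    idem : ∀ b → indicator b * indicator b ≡ indicator b
    idem true  = refl
    idem false = refl

  A²-adjacent : ∀ {i j} → Adj Γ i j → (A ⊗ A) i j ≡ 0ℤ
  A²-adjacent {i} {j} ij = sum-zero _ λ l → path-vanishes i l j λ (il , lj) → no-triangle il lj (adj-sym ij)

  A²-nonadjacent : ∀ {i j} → ¬ i ≡ j → ¬ Adj Γ i j → (A ⊗ A) i j ≡ 1ℤ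
  A²-nonadjacent {i} {j} i≢j i≁j =
    let l , il , lj = common-neighbour i≢j i≁j in
    trans (sum-supported (λ l′ → A i l′ * A l′ j) l λ l′ l′≢l → path-vanishes i l′ j λ (il′ , l′j) →
      l′≢l (unique-common-neighbour i≢j il′ l′j il lj))
    (cong₂ _*_ (A-adj il) (A-adj lj))

  A² : ∀ i j → (A ⊗ A) i j ≡ (+ k - 1ℤ) * δ i j - A i j + 1ℤ
  A² i j with i ≟ j
  ... | yes refl = trans (A²-diagonal i) (sym (trans (cong₂ (λ d a → (+ k - 1ℤ) * d - a + 1ℤ) (δ-diag i) (cong indicator (loopless i))) (simplify (+ k))))
    where
    simplify : ∀ k → (k - 1ℤ) * 1ℤ - 0ℤ + 1ℤ ≡ k
    simplify = solve-∀
  ... | no i≢j = by-adjacency (adj i j Bool.≟ true)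
    where
    off-diagonal : ∀ a → A i j ≡ a → (+ k - 1ℤ) * δ i j - A i j + 1ℤ ≡ 1ℤ - a
    off-diagonal a eq = trans (cong₂ (λ d a → (+ k - 1ℤ) * d - a + 1ℤ) (δ-off i≢j) eq) (simplify (+ k) a)
      where
      simplify : ∀ k a → (k - 1ℤ) * 0ℤ - a + 1ℤ ≡ 1ℤ - a
      simplify = solve-∀
    by-adjacency : _ → (A ⊗ A) i j ≡ (+ k - 1ℤ) * δ i j - A i j + 1ℤ
    by-adjacency (yes ij) = trans (A²-adjacent ij) (sym (off-diagonal 1ℤ (A-adj ij)))
    by-adjacency (no i≁j) = trans (A²-nonadjacent i≢j i≁j) (sym (off-diagonal 0ℤ (cong indicator (¬-not i≁j))))

  -- Row `u` of `A ⊗ A` is summed in two ways: by regularity it gives `k * k`, and by `A²` it gives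
  -- `(k − 1) − k + n`.
  size : Fin n → + n ≡ + k * + k + 1ℤ
  size u = begin
    + n                                                            ≡⟨ isolate (+ n) (+ k) ⟩
    ((+ k - 1ℤ) - + k + + n) + 1ℤ                                  ≡⟨ cong (_+ 1ℤ) (begin
      (+ k - 1ℤ) - + k + + n                                         ≡⟨ cong₂ (λ x y → x - + k + y) (sym (sum-δˡ u (λ _ → + k - 1ℤ))) (sym (ℤP.*-identityʳ (+ n))) ⟩
      sum (λ j → δ u j * (+ k - 1ℤ)) - + k + + n * 1ℤ                ≡⟨ cong₂ (λ x y → sum (λ j → δ u j * (+ k - 1ℤ)) - x + y) (sym (A-row-sum u)) (sym (sum-const n 1ℤ)) ⟩
      sum (λ j → δ u j * (+ k - 1ℤ)) - sum (A u) + sum {n} (λ _ → 1ℤ) ≡⟨ cong (_+ sum {n} (λ _ → 1ℤ)) (trans (∑-distrib-+ (λ j → δ u j * (+ k - 1ℤ)) (λ j → - A u j)) (cong (_+_ (sum (λ j → δ u j * (+ k - 1ℤ)))) (sum-neg (A u)))) ⟨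
      sum (λ j → δ u j * (+ k - 1ℤ) - A u j) + sum {n} (λ _ → 1ℤ)      ≡⟨ ∑-distrib-+ (λ j → δ u j * (+ k - 1ℤ) - A u j) (λ _ → 1ℤ) ⟨
      sum (λ j → δ u j * (+ k - 1ℤ) - A u j + 1ℤ)                     ≡⟨ sum-cong-≗ (λ j → trans (cong (λ x → x - A u j + 1ℤ) (ℤP.*-comm (δ u j) (+ k - 1ℤ))) (sym (A² u j))) ⟩
      sum (λ j → sum (λ l → A u l * A l j))                          ≡⟨ ∑-comm (λ j l → A u l * A l j) ⟩
      sum (λ l → sum (λ j → A u l * A l j))                          ≡⟨ sum-cong-≗ (λ l → trans (sym (*-distribˡ-sum (A u l) (A l))) (cong (A u l *_) (A-row-sum l))) ⟩
      sum (λ l → A u l * + k)                                        ≡⟨ *-distribʳ-sum (+ k) (A u) ⟨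
      sum (A u) * + k                                                ≡⟨ cong (_* + k) (A-row-sum u) ⟩
      + k * + k                                                      ∎) ⟩
    + k * + k + 1ℤ                                                 ∎
    where
    open ≡-Reasoning
    isolate : ∀ n k → n ≡ ((k - 1ℤ) - k + n) + 1ℤ
    isolate = solve-∀

  Lap : Mat n
  Lap i j = + k * δ i j - A i j

  Laplacian≡ : ∀ x i → Laplacian Γ x i ≡ sum (λ j → Lap i j * x j)
  Laplacian≡ x i = sym (begin
    sum (λ j → (+ k * δ i j - A i j) * x j)                        ≡⟨ sum-cong-≗ (λ j → trans (expand (+ k) (δ i j) (A i j) (x j)) (cong (λ y → δ i j * (+ k * x j) - y) (select (adj i j) (x j)))) ⟩
    sum (λ j → δ i j * (+ k * x j) - (if adj i j then x j else 0ℤ))    ≡⟨ trans (∑-distrib-+ (λ j → δ i j * (+ k * x j)) (λ j → - (if adj i j then x j else 0ℤ))) (cong₂ _+_ (sum-δˡ i (λ j → + k * x j)) (sum-neg (λ j → if adj i j then x j else 0ℤ))) ⟩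
    + k * x i - sum (λ j → if adj i j then x j else 0ℤ)            ≡⟨ cong₂ (λ d s → + d * x i - s) (regular i) (sumℤ≡sum (λ j → if adj i j then x j else 0ℤ)) ⟨
    + degree Γ i * x i - sumℤ n (λ j → if adj i j then x j else 0ℤ) ∎)
    where
    open ≡-Reasoning
    expand : ∀ k d a x → (k * d - a) * x ≡ d * (k * x) - a * x
    expand = solve-∀
    select : ∀ b x → indicator b * x ≡ (if b then x else 0ℤ)
    select true  x = ℤP.*-identityˡ x
    select false x = ℤP.*-zeroˡ x

  Lap-row-sum : ∀ i → sum (Lap i) ≡ 0ℤ
  Lap-row-sum i = begin
    sum (λ j → + k * δ i j - A i j)                 ≡⟨ ∑-distrib-+ (λ j → + k * δ i j) (λ j → - A i j) ⟩
    sum (λ j → + k * δ i j) + sum (λ j → - A i j)   ≡⟨ cong₂ _+_ (trans (sum-cong-≗ λ j → ℤP.*-comm (+ k) (δ i j)) (sum-δˡ i (λ _ → + k))) (trans (sum-neg (A i)) (cong -_ (A-row-sum i))) ⟩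
    + k - + k                                       ≡⟨ ℤP.+-inverseʳ (+ k) ⟩
    0ℤ                                              ∎
    where open ≡-Reasoning

  Lap-sym : ∀ i j → Lap i j ≡ Lap j i
  Lap-sym i j = cong₂ (λ d a → + k * d - a) (δ-sym i j) (A-sym i j)

  -- Expand `(k I − A)²`, replace `A ⊗ A` by means of `A²`, and rewrite `A` as `k I − Lap`.
  Lap-square : ∀ i j → (Lap ⊗ Lap) i j ≡ Combination.comb Lap (- (+ k * + k + 1ℤ)) (+ k + + k + 1ℤ) 1ℤ i j
  Lap-square i j = begin
    sum (λ l → Lap i l * (+ k * δ l j - A l j))                ≡⟨ sum-cong-≗ (λ l → split₁ (Lap i l) (+ k) (δ l j) (A l j)) ⟩
    sum (λ l → Lap i l * + k * δ l j - Lap i l * A l j)        ≡⟨ trans (∑-distrib-+ (λ l → Lap i l * + k * δ l j) (λ l → - (Lap i l * A l j))) (cong₂ _+_ (sum-δʳ j (λ l → Lap i l * + k)) (sum-neg (λ l → Lap i l * A l j))) ⟩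
    Lap i j * + k - sum (λ l → Lap i l * A l j)                ≡⟨ cong (λ s → Lap i j * + k - s) (begin
      sum (λ l → (+ k * δ i l - A i l) * A l j)                  ≡⟨ sum-cong-≗ (λ l → split₂ (+ k) (δ i l) (A i l) (A l j)) ⟩
      sum (λ l → δ i l * (+ k * A l j) - A i l * A l j)          ≡⟨ trans (∑-distrib-+ (λ l → δ i l * (+ k * A l j)) (λ l → - (A i l * A l j))) (cong₂ _+_ (sum-δˡ i (λ l → + k * A l j)) (sum-neg (λ l → A i l * A l j))) ⟩
      + k * A i j - (A ⊗ A) i j                                  ≡⟨ cong (λ s → + k * A i j - s) (A² i j) ⟩
      + k * A i j - ((+ k - 1ℤ) * δ i j - A i j + 1ℤ)            ∎) ⟩
    Lap i j * + k - (+ k * A i j - ((+ k - 1ℤ) * δ i j - A i j + 1ℤ))  ≡⟨ collect (+ k) (δ i j) (A i j) ⟩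
    Combination.comb Lap (- (+ k * + k + 1ℤ)) (+ k + + k + 1ℤ) 1ℤ i j   ∎
    where
    open ≡-Reasoning
    split₁ : ∀ l k d a → l * (k * d - a) ≡ l * k * d - l * a
    split₁ = solve-∀
    split₂ : ∀ k d a b → (k * d - a) * b ≡ d * (k * b) - a * b
    split₂ = solve-∀
    collect : ∀ k d a → (k * d - a) * k - (k * a - ((k - 1ℤ) * d - a + 1ℤ)) ≡ - (k * k + 1ℤ) * d + (k + k + 1ℤ) * (k * d - a) + 1ℤ * 1ℤ
    collect = solve-∀

  tr-Lap : tr Lap ≡ + n * + k
  tr-Lap = trans (sum-cong-≗ λ i → trans (cong₂ (λ d a → + k * d - a) (δ-diag i) (cong indicator (loopless i))) (simplify (+ k))) (sum-const n (+ k))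
    where
    simplify : ∀ k → k * 1ℤ - 0ℤ ≡ k
    simplify = solve-∀

  relations : Fin n → ∀ ℓ μ → ℓ * μ ≡ + k * + k + 1ℤ → ℓ + μ ≡ + k + + k + 1ℤ → LaplacianRelations Lap ℓ μ
  relations u ℓ μ ℓμ ℓ+μ = record
    { size    = trans (size u) (sym ℓμ)
    ; row-sum = Lap-row-sum
    ; col-sum = λ j → trans (sum-cong-≗ λ i → Lap-sym i j) (Lap-row-sum j)
    ; square  = λ i j → trans (Lap-square i j) (sym (cong₂ (λ x y → Combination.comb Lap (- x) y 1ℤ i j) ℓμ ℓ+μ))
    }

-- Finitely generated abelian groups

Group : Set₁
Group = AbelianGroup 0ℓ 0ℓ

-- Tuples are functions compared pointwise, so membership must be required to respect `_≗_`.
record IsSubgroup {n} (H : (Fin n → ℤ) → Set) : Set where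
  field
    resp   : ∀ {x y} → x ≗ y → H x → H y
    0-mem  : H (λ _ → 0ℤ)
    +-mem  : ∀ {x y} → H x → H y → H (λ i → x i + y i)
    neg-mem : ∀ {x} → H x → H (λ i → - x i)

record Congruent {n} (H : (Fin n → ℤ) → Set) (x y : Fin n → ℤ) : Set where
  constructor congruent
  field difference : H (λ i → x i - y i)

module _ {n} {H : (Fin n → ℤ) → Set} (isSubgroup : IsSubgroup H) where
  open IsSubgroup isSubgroup

  ≗⇒congruent : ∀ {x y} → x ≗ y → Congruent H x y
  ≗⇒congruent {x} {y} x≗y = congruent (resp (λ i → sym (trans (cong (_- y i) (x≗y i)) (ℤP.+-inverseʳ (y i)))) 0-mem)

  quotient : Group
  quotient = record
    { Carrier = Fin n → ℤ
    ; _≈_     = Congruent H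
    ; _∙_     = λ x y i → x i + y i
    ; ε       = λ _ → 0ℤ
    ; _⁻¹     = λ x i → - x i
    ; isAbelianGroup = record
      { isGroup = record
        { isMonoid = record
          { isSemigroup = record
            { isMagma = record
              { isEquivalence = record
                { refl  = ≗⇒congruent λ _ → refl
                ; sym   = λ {x} {y} (congruent p) → congruent (resp (λ i → flip (x i) (y i)) (neg-mem p))
                ; trans = λ {x} {y} {z} (congruent p) (congruent q) → congruent (resp (λ i → chain (x i) (y i) (z i)) (+-mem p q))
                }
              ; ∙-cong = λ {x} {y} {u} {v} (congruent p) (congruent q) → congruent (resp (λ i → interchange (x i) (y i) (u i) (v i)) (+-mem p q))
              }
            ; assoc = λ x y z → ≗⇒congruent λ i → ℤP.+-assoc (x i) (y i) (z i)
            }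
          ; identity = (λ x → ≗⇒congruent λ i → ℤP.+-identityˡ (x i)) , λ x → ≗⇒congruent λ i → ℤP.+-identityʳ (x i)
          }
        ; inverse = (λ x → ≗⇒congruent λ i → ℤP.+-inverseˡ (x i)) , λ x → ≗⇒congruent λ i → ℤP.+-inverseʳ (x i)
        ; ⁻¹-cong = λ {x} {y} (congruent p) → congruent (resp (λ i → negate (x i) (y i)) (neg-mem p))
        }
      ; comm = λ x y → ≗⇒congruent λ i → ℤP.+-comm (x i) (y i)
      }
    }
    where
    flip : ∀ x y → - (x - y) ≡ y - x
    flip = solve-∀
    chain : ∀ x y z → x - y + (y - z) ≡ x - z
    chain = solve-∀
    interchange : ∀ x y u v → x - y + (u - v) ≡ x + u - (y + v)
    interchange = solve-∀
    negate : ∀ x y → - (x - y) ≡ - x - - y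
    negate = solve-∀

∣-isSubgroup : ∀ {n} (d : Fin n → ℤ) → IsSubgroup (λ x → ∀ i → d i ∣ x i)
∣-isSubgroup d = record
  { resp    = λ x≗y d∣x i → subst (d i ∣_) (x≗y i) (d∣x i)
  ; 0-mem   = λ i → divides 0ℤ (sym (ℤP.*-zeroˡ (d i)))
  ; +-mem   = λ d∣x d∣y i → ∣m∣n⇒∣m+n (d∣x i) (d∣y i)
  ; neg-mem = λ d∣x i → ∣m⇒∣-m (d∣x i)
  }

-- A zero modulus is allowed and contributes a copy of ℤ, since `0ℤ ∣ x` means that `x` is zero.
⊕ℤ/ : ∀ {n} → (Fin n → ℤ) → Group
⊕ℤ/ d = quotient (∣-isSubgroup d)

ℤ/ : ℤ → Group
ℤ/ d = ⊕ℤ/ {1} λ _ → d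

moduli : (ms : List ℕ) → Fin (length ms) → ℤ
moduli ms i = + lookup ms i

_▷_ : ∀ {n} → Mat n → (Fin n → ℤ) → Fin n → ℤ
(M ▷ x) i = sum λ j → M i j * x j

▷-congʳ : ∀ {n} (M : Mat n) {x y} → x ≗ y → M ▷ x ≗ M ▷ y
▷-congʳ M x≗y i = sum-cong-≗ λ j → cong (M i j *_) (x≗y j)

▷-congˡ : ∀ {n} {M N : Mat n} x → M ≋ N → M ▷ x ≗ N ▷ x
▷-congˡ x M≋N i = sum-cong-≗ λ j → cong (_* x j) (at M≋N i j)

▷-+ : ∀ {n} (M : Mat n) x y → M ▷ (λ i → x i + y i) ≗ λ i → (M ▷ x) i + (M ▷ y) i
▷-+ M x y i = trans (sum-cong-≗ λ j → ℤP.*-distribˡ-+ (M i j) (x j) (y j)) (∑-distrib-+ (λ j → M i j * x j) (λ j → M i j * y j))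

▷-neg : ∀ {n} (M : Mat n) x → M ▷ (λ i → - x i) ≗ λ i → - (M ▷ x) i
▷-neg M x i = trans (sum-cong-≗ λ j → sym (ℤP.neg-distribʳ-* (M i j) (x j))) (sum-neg (λ j → M i j * x j))

▷-diff : ∀ {n} (M : Mat n) x y → M ▷ (λ i → x i - y i) ≗ λ i → (M ▷ x) i - (M ▷ y) i
▷-diff M x y i = trans (▷-+ M x (λ j → - y j) i) (cong (_+_ ((M ▷ x) i)) (▷-neg M y i))

▷-δ : ∀ {n} (x : Fin n → ℤ) → δ ▷ x ≗ x
▷-δ x i = sum-δˡ i x

▷-⊗ : ∀ {n} (M N : Mat n) x → (M ⊗ N) ▷ x ≗ M ▷ (N ▷ x)
▷-⊗ M N x i = begin
  sum (λ j → sum (λ k → M i k * N k j) * x j)    ≡⟨ sum-cong-≗ (λ j → *-distribʳ-sum (x j) (λ k → M i k * N k j)) ⟩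
  sum (λ j → sum (λ k → M i k * N k j * x j))    ≡⟨ ∑-comm (λ j k → M i k * N k j * x j) ⟩
  sum (λ k → sum (λ j → M i k * N k j * x j))    ≡⟨ sum-cong-≗ (λ k → sum-cong-≗ λ j → ℤP.*-assoc (M i k) (N k j) (x j)) ⟩
  sum (λ k → sum (λ j → M i k * (N k j * x j)))  ≡⟨ sum-cong-≗ (λ k → *-distribˡ-sum (M i k) (λ j → N k j * x j)) ⟨
  sum (λ k → M i k * sum (λ j → N k j * x j))    ∎
  where open ≡-Reasoning

diag-▷ : ∀ {n} (d x : Fin n → ℤ) → diag d ▷ x ≗ λ i → d i * x i
diag-▷ d x i = trans (sum-cong-≗ λ j → ℤP.*-assoc (d i) (δ i j) (x j)) (trans (sym (*-distribˡ-sum (d i) (λ j → δ i j * x j))) (cong (d i *_) (sum-δˡ i x)))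

Image : ∀ {n} → Mat n → (Fin n → ℤ) → Set
Image M x = ∃[ z ] M ▷ z ≗ x

Image-isSubgroup : ∀ {n} (M : Mat n) → IsSubgroup (Image M)
Image-isSubgroup M = record
  { resp    = λ x≗y (z , Mz) → z , λ i → trans (Mz i) (x≗y i)
  ; 0-mem   = (λ _ → 0ℤ) , λ i → sum-zero (λ j → M i j * 0ℤ) λ j → ℤP.*-zeroʳ (M i j)
  ; +-mem   = λ (z , Mz) (w , Mw) → (λ i → z i + w i) , λ i → trans (▷-+ M z w i) (cong₂ _+_ (Mz i) (Mw i))
  ; neg-mem = λ (z , Mz) → (λ i → - z i) , λ i → trans (▷-neg M z i) (cong -_ (Mz i))
  }

coker : ∀ {n} → Mat n → Group
coker M = quotient (Image-isSubgroup M)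

-- Isomorphisms and direct sums of cyclic groups

infix 4 _≅_

record _≅_ (A B : Group) : Set where
  private
    module A = AbelianGroup A
    module B = AbelianGroup B
  field
    to        : A.Carrier → B.Carrier
    from      : B.Carrier → A.Carrier
    to-cong   : ∀ {x y} → x A.≈ y → to x B.≈ to y
    from-cong : ∀ {x y} → x B.≈ y → from x A.≈ from y
    to-∙      : ∀ x y → to (x A.∙ y) B.≈ to x B.∙ to y
    to-from   : ∀ y → to (from y) B.≈ y
    from-to   : ∀ x → from (to x) A.≈ x

≅-refl : ∀ {A} → A ≅ A
≅-refl {A} = record { to = id ; from = id ; to-cong = id ; from-cong = id ; to-∙ = λ x y → A.refl ; to-from = λ x → A.refl ; from-to = λ x → A.refl }
  where module A = AbelianGroup A

≅-sym : ∀ {A B} → A ≅ B → B ≅ A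
≅-sym {A} {B} φ = record
  { to        = from
  ; from      = to
  ; to-cong   = from-cong
  ; from-cong = to-cong
  ; to-∙      = λ x y → A.trans (from-cong (B.trans (B.∙-cong (B.sym (to-from x)) (B.sym (to-from y))) (B.sym (to-∙ (from x) (from y))))) (from-to _)
  ; to-from   = from-to
  ; from-to   = to-from
  }
  where
  open _≅_ φ
  module A = AbelianGroup A
  module B = AbelianGroup B

≅-trans : ∀ {A B C} → A ≅ B → B ≅ C → A ≅ C
≅-trans {A} {B} {C} φ ψ = record
  { to        = ψ.to ∘ φ.to
  ; from      = φ.from ∘ ψ.from
  ; to-cong   = λ p → ψ.to-cong (φ.to-cong p)
  ; from-cong = λ p → φ.from-cong (ψ.from-cong p)
  ; to-∙      = λ x y → C.trans (ψ.to-cong (φ.to-∙ x y)) (ψ.to-∙ (φ.to x) (φ.to y))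
  ; to-from   = λ z → C.trans (ψ.to-cong (φ.to-from (ψ.from z))) (ψ.to-from z)
  ; from-to   = λ x → A.trans (φ.from-cong (ψ.from-to (φ.to x))) (φ.from-to x)
  }
  where
  module φ = _≅_ φ
  module ψ = _≅_ ψ
  module A = AbelianGroup A
  module C = AbelianGroup C

infixr 5 _⊞_

_⊞_ : Group → Group → Group
_⊞_ = DirectProduct.abelianGroup

⊞-cong : ∀ {A A′ B B′} → A ≅ A′ → B ≅ B′ → A ⊞ B ≅ A′ ⊞ B′
⊞-cong φ ψ = record
  { to        = λ (x , y) → φ.to x , ψ.to y
  ; from      = λ (x , y) → φ.from x , ψ.from y
  ; to-cong   = λ (p , q) → φ.to-cong p , ψ.to-cong q
  ; from-cong = λ (p , q) → φ.from-cong p , ψ.from-cong q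
  ; to-∙      = λ (x , y) (x′ , y′) → φ.to-∙ x x′ , ψ.to-∙ y y′
  ; to-from   = λ (x , y) → φ.to-from x , ψ.to-from y
  ; from-to   = λ (x , y) → φ.from-to x , ψ.from-to y
  }
  where
  module φ = _≅_ φ
  module ψ = _≅_ ψ

⊞-swap : ∀ A B C → A ⊞ (B ⊞ C) ≅ B ⊞ (A ⊞ C)
⊞-swap A B C = record
  { to        = λ (x , y , z) → y , x , z
  ; from      = λ (y , x , z) → x , y , z
  ; to-cong   = λ (p , q , r) → q , p , r
  ; from-cong = λ (q , p , r) → p , q , r
  ; to-∙      = λ x y → B.refl , A.refl , C.refl
  ; to-from   = λ x → B.refl , A.refl , C.refl
  ; from-to   = λ x → A.refl , B.refl , C.refl
  }
  where
  module A = AbelianGroup A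
  module B = AbelianGroup B
  module C = AbelianGroup C

⊞-assoc : ∀ A B C → (A ⊞ B) ⊞ C ≅ A ⊞ (B ⊞ C)
⊞-assoc A B C = record
  { to        = λ ((x , y) , z) → x , y , z
  ; from      = λ (x , y , z) → (x , y) , z
  ; to-cong   = λ ((p , q) , r) → p , q , r
  ; from-cong = λ (p , q , r) → (p , q) , r
  ; to-∙      = λ x y → A.refl , B.refl , C.refl
  ; to-from   = λ x → A.refl , B.refl , C.refl
  ; from-to   = λ x → (A.refl , B.refl) , C.refl
  }
  where
  module A = AbelianGroup A
  module B = AbelianGroup B
  module C = AbelianGroup C

-- Associated moduli define the same subgroup; this is how signs of diagonal entries are discarded.
⊕ℤ/-≗ : ∀ {n} {d e : Fin n → ℤ} → (∀ i → d i ∣ e i) → (∀ i → e i ∣ d i) → ⊕ℤ/ d ≅ ⊕ℤ/ e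
⊕ℤ/-≗ {d = d} {e} d∣e e∣d = record
  { to        = id
  ; from      = id
  ; to-cong   = λ (congruent p) → congruent λ i → ∣-trans (e∣d i) (p i)
  ; from-cong = λ (congruent p) → congruent λ i → ∣-trans (d∣e i) (p i)
  ; to-∙      = λ x y → E.refl
  ; to-from   = λ x → E.refl
  ; from-to   = λ x → D.refl
  }
  where
  module D = AbelianGroup (⊕ℤ/ d)
  module E = AbelianGroup (⊕ℤ/ e)

⊕ℤ/-suc : ∀ {n} (d : Fin (suc n) → ℤ) → ⊕ℤ/ d ≅ ℤ/ (d zero) ⊞ ⊕ℤ/ (d ∘ suc)
⊕ℤ/-suc {n} d = record
  { to        = λ x → (λ _ → x zero) , x ∘ suc
  ; from      = λ (a , x) → a zero ∷ᶠ x
  ; to-cong   = λ (congruent p) → congruent (λ _ → p zero) , congruent (p ∘ suc)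
  ; from-cong = λ (congruent p , congruent q) → congruent λ { zero → p zero ; (suc i) → q i }
  ; to-∙      = λ x y → Head.refl , Tail.refl
  ; to-from   = λ (a , x) → ≗⇒congruent (∣-isSubgroup {1} _) (λ { zero → refl }) , Tail.refl
  ; from-to   = λ x → ≗⇒congruent (∣-isSubgroup d) λ { zero → refl ; (suc i) → refl }
  }
  where
  module Head = AbelianGroup (ℤ/ (d zero))
  module Tail = AbelianGroup (⊕ℤ/ (d ∘ suc))

ℤ/1-⊞ : ∀ A → ℤ/ 1ℤ ⊞ A ≅ A
ℤ/1-⊞ A = record
  { to        = proj₂
  ; from      = λ x → (λ _ → 0ℤ) , x
  ; to-cong   = proj₂
  ; from-cong = λ p → trivial , p
  ; to-∙      = λ x y → A.refl
  ; to-from   = λ x → A.refl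
  ; from-to   = λ x → trivial , A.refl
  }
  where
  module A = AbelianGroup A
  trivial : ∀ {x y} → Congruent (λ x → ∀ i → 1ℤ ∣ x i) x y
  trivial {x} {y} = congruent λ i → divides (x i - y i) (sym (ℤP.*-identityʳ (x i - y i)))

-- By the Bézout identity `b * v` is 1 modulo `a` and `a * u` is 1 modulo `b`; both vanish modulo
-- the other factor, so they are the weights of the inverse map.
ℤ/-CRT : ∀ a b u v → a * u + b * v ≡ 1ℤ → ℤ/ (a * b) ≅ ℤ/ a ⊞ ℤ/ b
ℤ/-CRT a b u v au+bv≡1 = record
  { to        = λ x → x , x
  ; from      = λ (y , z) i → y i * (b * v) + z i * (a * u)
  ; to-cong   = λ (congruent p) → congruent (λ i → ∣-trans (divides b (ℤP.*-comm a b)) (p i)) , congruent (λ i → ∣-trans (divides a refl) (p i))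
  ; from-cong = λ {(y , z)} {(y′ , z′)} (congruent p , congruent q) → congruent λ i → from-cong′ (y i) (y′ i) (z i) (z′ i) (p i) (q i)
  ; to-∙      = λ x y → A.refl , B.refl
  ; to-from   = λ (y , z) → congruent (λ i → divides (u * (z i - y i)) (mod-a (y i) (z i))) , congruent (λ i → divides (v * (y i - z i)) (mod-b (y i) (z i)))
  ; from-to   = λ x → ≗⇒congruent (∣-isSubgroup {1} _) λ i → recombine (x i)
  }
  where
  module A = AbelianGroup (ℤ/ a)
  module B = AbelianGroup (ℤ/ b)
  open ≡-Reasoning
  from-cong′ : ∀ y y′ z z′ → a ∣ y - y′ → b ∣ z - z′ → a * b ∣ y * (b * v) + z * (a * u) - (y′ * (b * v) + z′ * (a * u))
  from-cong′ y y′ z z′ (divides q y≡) (divides r z≡) = divides (q * v + r * u) (begin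
    y * (b * v) + z * (a * u) - (y′ * (b * v) + z′ * (a * u))   ≡⟨ collect y y′ z z′ (b * v) (a * u) ⟩
    (y - y′) * (b * v) + (z - z′) * (a * u)                     ≡⟨ cong₂ (λ s t → s * (b * v) + t * (a * u)) y≡ z≡ ⟩
    q * a * (b * v) + r * b * (a * u)                           ≡⟨ factor q r a b u v ⟩
    (q * v + r * u) * (a * b)                                   ∎)
    where
    collect : ∀ y y′ z z′ s t → y * s + z * t - (y′ * s + z′ * t) ≡ (y - y′) * s + (z - z′) * t
    collect = solve-∀
    factor : ∀ q r a b u v → q * a * (b * v) + r * b * (a * u) ≡ (q * v + r * u) * (a * b)
    factor = solve-∀
  mod-a : ∀ y z → y * (b * v) + z * (a * u) - y ≡ u * (z - y) * a
  mod-a y z = trans (cong (λ s → y * (b * v) + z * (a * u) - s) (trans (sym (ℤP.*-identityʳ y)) (cong (y *_) (sym au+bv≡1)))) (factor y z a b u v)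
    where
    factor : ∀ y z a b u v → y * (b * v) + z * (a * u) - y * (a * u + b * v) ≡ u * (z - y) * a
    factor = solve-∀
  mod-b : ∀ y z → y * (b * v) + z * (a * u) - z ≡ v * (y - z) * b
  mod-b y z = trans (cong (λ s → y * (b * v) + z * (a * u) - s) (trans (sym (ℤP.*-identityʳ z)) (cong (z *_) (sym au+bv≡1)))) (factor y z a b u v)
    where
    factor : ∀ y z a b u v → y * (b * v) + z * (a * u) - z * (a * u + b * v) ≡ v * (y - z) * b
    factor = solve-∀
  recombine : ∀ x → x * (b * v) + x * (a * u) ≡ x
  recombine x = trans (factor x (a * u) (b * v)) (trans (cong (x *_) au+bv≡1) (ℤP.*-identityʳ x))
    where
    factor : ∀ x s t → x * t + x * s ≡ x * (s + t)
    factor = solve-∀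

-- `P′ ⊗ M ≋ diag d ⊗ Q` with `Q` invertible, so the automorphism `P′` of the lattice carries the
-- image of `M` onto that of `diag d`.
coker-diagonal : ∀ {n} (M : Mat n) d → M ~ diag d → coker M ≅ ⊕ℤ/ d
coker-diagonal {n} M d (equivalent {P} {Q} (invertible P′ PP′ P′P) (invertible Q′ QQ′ Q′Q) M≋) = record
  { to        = P′ ▷_
  ; from      = P ▷_
  ; to-cong   = λ {x} {y} (congruent (z , Mz)) → congruent λ i → divides ((Q ▷ z) i) (begin
      (P′ ▷ x) i - (P′ ▷ y) i           ≡⟨ ▷-diff P′ x y i ⟨
      (P′ ▷ (λ j → x j - y j)) i        ≡⟨ ▷-congʳ P′ Mz i ⟨
      (P′ ▷ (M ▷ z)) i                  ≡⟨ ▷-⊗ P′ M z i ⟨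
      ((P′ ⊗ M) ▷ z) i                  ≡⟨ ▷-congˡ z P′M≋ i ⟩
      ((diag d ⊗ Q) ▷ z) i              ≡⟨ ▷-⊗ (diag d) Q z i ⟩
      (diag d ▷ (Q ▷ z)) i              ≡⟨ diag-▷ d (Q ▷ z) i ⟩
      d i * (Q ▷ z) i                   ≡⟨ ℤP.*-comm (d i) ((Q ▷ z) i) ⟩
      (Q ▷ z) i * d i                   ∎)
  ; from-cong = λ {x} {y} (congruent p) → congruent (Q′ ▷ w p , λ i → begin
      (M ▷ (Q′ ▷ w p)) i                ≡⟨ ▷-⊗ M Q′ (w p) i ⟨
      ((M ⊗ Q′) ▷ w p) i                ≡⟨ ▷-congˡ (w p) MQ′≋ i ⟩
      ((P ⊗ diag d) ▷ w p) i            ≡⟨ ▷-⊗ P (diag d) (w p) i ⟩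
      (P ▷ (diag d ▷ w p)) i            ≡⟨ ▷-congʳ P (λ j → trans (diag-▷ d (w p) j) (trans (ℤP.*-comm (d j) (w p j)) (sym (_∣_.equality (p j))))) i ⟩
      (P ▷ (λ j → x j - y j)) i         ≡⟨ ▷-diff P x y i ⟩
      (P ▷ x) i - (P ▷ y) i             ∎)
  ; to-∙      = λ x y → ≗⇒congruent (∣-isSubgroup d) (▷-+ P′ x y)
  ; to-from   = λ y → ≗⇒congruent (∣-isSubgroup d) λ i → trans (sym (▷-⊗ P′ P y i)) (trans (▷-congˡ y P′P i) (▷-δ y i))
  ; from-to   = λ x → ≗⇒congruent (Image-isSubgroup M) λ i → trans (sym (▷-⊗ P P′ x i)) (trans (▷-congˡ x PP′ i) (▷-δ x i))
  }
  where
  open ≡-Reasoning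
  module R = ≋-Reasoning
  w : ∀ {z : Fin n → ℤ} → (∀ i → d i ∣ z i) → Fin n → ℤ
  w p i = _∣_.quotient (p i)
  P′M≋ : P′ ⊗ M ≋ diag d ⊗ Q
  P′M≋ = R.begin
    P′ ⊗ M                       R.≈⟨ ⊗-congˡ P′ M≋ ⟩
    P′ ⊗ (P ⊗ diag d ⊗ Q)        R.≈⟨ ⊗-Solver.solve 4 (λ p′ p e q → p′ ⊙ ((p ⊙ e) ⊙ q) ⊜ (p′ ⊙ p) ⊙ (e ⊙ q)) ≋-refl P′ P (diag d) Q ⟩
    P′ ⊗ P ⊗ (diag d ⊗ Q)        R.≈⟨ ⊗-congʳ (diag d ⊗ Q) P′P ⟩
    δ ⊗ (diag d ⊗ Q)             R.≈⟨ ⊗-identityˡ (diag d ⊗ Q) ⟩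
    diag d ⊗ Q                   R.∎
    where open ⊗-Solver using (_⊜_) renaming (_⊕_ to _⊙_)
  MQ′≋ : M ⊗ Q′ ≋ P ⊗ diag d
  MQ′≋ = R.begin
    M ⊗ Q′                       R.≈⟨ ⊗-congʳ Q′ M≋ ⟩
    P ⊗ diag d ⊗ Q ⊗ Q′          R.≈⟨ ⊗-assoc (P ⊗ diag d) Q Q′ ⟩
    P ⊗ diag d ⊗ (Q ⊗ Q′)        R.≈⟨ ⊗-congˡ (P ⊗ diag d) QQ′ ⟩
    P ⊗ diag d ⊗ δ               R.≈⟨ ⊗-identityʳ (P ⊗ diag d) ⟩
    P ⊗ diag d                   R.∎

-- Sorting the cyclic factors

⨁ : List ℕ → Group
⨁ ms = ⊕ℤ/ (moduli ms)

⨁-∷ : ∀ m ms → ℤ/ (+ m) ⊞ ⨁ ms ≅ ⨁ (m ∷ ms)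
⨁-∷ m ms = ≅-sym (⊕ℤ/-suc (moduli (m ∷ ms)))

-- Moves a new summand past the prefix `ws` to the place where `φ` can absorb it, which keeps the
-- list of moduli sorted.
⨁-insert : ∀ {m xs ys} ws → ℤ/ (+ m) ⊞ ⨁ xs ≅ ⨁ ys → ℤ/ (+ m) ⊞ ⨁ (ws ++ xs) ≅ ⨁ (ws ++ ys)
⨁-insert []       φ = φ
⨁-insert {m} {xs} {ys} (w ∷ ws) φ =
  ≅-trans (⊞-cong ≅-refl (≅-sym (⨁-∷ w (ws ++ xs))))
  (≅-trans (⊞-swap (ℤ/ (+ m)) (ℤ/ (+ w)) (⨁ (ws ++ xs)))
  (≅-trans (⊞-cong ≅-refl (⨁-insert ws φ)) (⨁-∷ w (ws ++ ys))))

-- The clause that `p` does not divide `q` is what makes the counts of the summands ℤ/2 and ℤ/13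
-- exact later.
∣prime*⇒ : ∀ {p q k} → Prime p → q ℕD.∣ p ℕ.* k →
  (q ℕD.∣ k × ¬ (p ℕD.∣ q)) ⊎ (∃[ q′ ] q ≡ p ℕ.* q′ × q′ ℕD.∣ k)
∣prime*⇒ {p} {q} {k} p-prime q∣pk with p ℕD.∣? q
... | yes (ℕD.divides q′ q≡q′p) = inj₂ (q′ , q≡pq′ , ℕD.*-cancelˡ-∣ p {{prime⇒nonZero p-prime}} (subst (ℕD._∣ p ℕ.* k) q≡pq′ q∣pk))
  where q≡pq′ = trans q≡q′p (ℕP.*-comm q′ p)
... | no p∤q = inj₁ (ℕC.coprime-divisor coprime q∣pk , p∤q)
  where
  coprime : ℕC.Coprime q p
  coprime (d∣q , d∣p) with prime⇒irreducible p-prime d∣p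
  ... | inj₁ d≡1  = d≡1
  ... | inj₂ refl = contradiction d∣q p∤q

∣prime-power⇒ : ∀ {p q} → Prime p → ∀ k → q ℕD.∣ p ℕ.^ k → ∃[ j ] j ℕ.≤ k × q ≡ p ℕ.^ j
∣prime-power⇒ p-prime zero    q∣1 = 0 , ℕ.z≤n , ℕD.∣1⇒≡1 q∣1
∣prime-power⇒ {p} p-prime (suc k) q∣ with ∣prime*⇒ p-prime q∣
... | inj₁ (q∣ , _) = let j , j≤k , q≡ = ∣prime-power⇒ p-prime k q∣ in j , ℕP.m≤n⇒m≤1+n j≤k , q≡
... | inj₂ (q′ , q≡ , q′∣) = let j , j≤k , q′≡ = ∣prime-power⇒ p-prime k q′∣ in suc j , ℕ.s≤s j≤k , trans q≡ (cong (p ℕ.*_) q′≡)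

-- One Bézout identity for `p` and `k` serves every divisor `q` of `k`: the cofactor `t` is moved
-- into the coefficient.
ℤ/-split : ∀ p q k u v → + p * u + + k * v ≡ 1ℤ → q ℕD.∣ k → ℤ/ (+ (p ℕ.* q)) ≅ ℤ/ (+ p) ⊞ ℤ/ (+ q)
ℤ/-split p q k u v bezout (ℕD.divides t k≡tq) = subst (λ x → ℤ/ x ≅ ℤ/ (+ p) ⊞ ℤ/ (+ q)) (sym (ℤP.pos-* p q))
  (ℤ/-CRT (+ p) (+ q) u (+ t * v) (trans (cong (_+_ (+ p * u)) qtv≡kv) bezout))
  where
  swap : ∀ q t v → q * (t * v) ≡ t * q * v
  swap = solve-∀
  qtv≡kv : + q * (+ t * v) ≡ + k * v
  qtv≡kv = trans (swap (+ q) (+ t) v) (cong (_* v) (trans (sym (ℤP.pos-* t q)) (cong +_ (sym k≡tq))))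

2-prime : Prime 2
2-prime = from-yes (prime? 2)

5-prime : Prime 5
5-prime = from-yes (prime? 5)

13-prime : Prime 13
13-prime = from-yes (prime? 13)

5-part : ℕ × ℕ × ℕ → List ℕ
5-part (e₁ , e₂ , e₃) = replicate e₁ 5 ++ replicate e₂ 25 ++ replicate e₃ 125

-- The `z` zero moduli are the free part. They stand first so that, once `z` is known to be 1, the
-- head coordinate is the free one.
sorted : ℕ → ℕ → ℕ → ℕ × ℕ × ℕ → List ℕ
sorted z a b e = replicate z 0 ++ replicate a 2 ++ replicate b 13 ++ 5-part e

module _ (z a b : ℕ) where

  add-0 : ∀ e → ℤ/ 0ℤ ⊞ ⨁ (sorted z a b e) ≅ ⨁ (sorted (suc z) a b e)
  add-0 e = ⨁-∷ 0 (sorted z a b e)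

  add-2 : ∀ e → ℤ/ (+ 2) ⊞ ⨁ (sorted z a b e) ≅ ⨁ (sorted z (suc a) b e)
  add-2 e = ⨁-insert (replicate z 0) (⨁-∷ 2 _)

  add-13 : ∀ e → ℤ/ (+ 13) ⊞ ⨁ (sorted z a b e) ≅ ⨁ (sorted z a (suc b) e)
  add-13 e = ⨁-insert (replicate z 0) (⨁-insert (replicate a 2) (⨁-∷ 13 _))

  add-5-part : ∀ {m} e e′ → ℤ/ (+ m) ⊞ ⨁ (5-part e) ≅ ⨁ (5-part e′) → ℤ/ (+ m) ⊞ ⨁ (sorted z a b e) ≅ ⨁ (sorted z a b e′)
  add-5-part e e′ φ = ⨁-insert (replicate z 0) (⨁-insert (replicate a 2) (⨁-insert (replicate b 13) φ))

  absorb-5 : ∀ q e → q ℕD.∣ 125 → ∃[ e′ ] ℤ/ (+ q) ⊞ ⨁ (sorted z a b e) ≅ ⨁ (sorted z a b e′)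
  absorb-5 q e@(e₁ , e₂ , e₃) q∣125 with ∣prime-power⇒ 5-prime 3 q∣125
  ... | 0 , _ , refl = e , ℤ/1-⊞ _
  ... | 1 , _ , refl = (suc e₁ , e₂ , e₃) , add-5-part e (suc e₁ , e₂ , e₃) (⨁-∷ 5 _)
  ... | 2 , _ , refl = (e₁ , suc e₂ , e₃) , add-5-part e (e₁ , suc e₂ , e₃) (⨁-insert (replicate e₁ 5) (⨁-∷ 25 _))
  ... | 3 , _ , refl = (e₁ , e₂ , suc e₃) , add-5-part e (e₁ , e₂ , suc e₃) (⨁-insert (replicate e₁ 5) (⨁-insert (replicate e₂ 25) (⨁-∷ 125 _)))
  ... | suc (suc (suc (suc _))) , ℕ.s≤s (ℕ.s≤s (ℕ.s≤s ())) , _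

-- Bookkeeping of the factors 2 and 13

∤-count : ℤ → ℤ → ℕ
∤-count p x = if p ∤ᵇ x then 1 else 0

∤-count-∣ : ∀ p x → p ∣ x → ∤-count p x ≡ 0
∤-count-∣ p x p∣x = cong (λ b → if not b then 1 else 0) (dec-true (p ∣? x) p∣x)

∤-count-∤ : ∀ p x → ¬ (p ∣ x) → ∤-count p x ≡ 1
∤-count-∤ p x p∤x = cong (λ b → if not b then 1 else 0) (dec-false (p ∣? x) p∤x)

∤-count-cong : ∀ p x y → (p ∣ x → p ∣ y) → (p ∣ y → p ∣ x) → ∤-count p x ≡ ∤-count p y
∤-count-cong p x y to from = cong (λ b → if not b then 1 else 0) (does-⇔ (mk⇔ to from) (p ∣? x) (p ∣? y))

module _ (z a : ℕ) where

  -- The final equation says, without subtraction, that `b` grows by one exactly when 13 divides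
  -- `q`; in this form it adds up along `count`.
  absorb-13 : ∀ b q e → q ℕD.∣ 13 ℕ.* 125 →
    ∃[ b′ ] ∃[ e′ ] ℤ/ (+ q) ⊞ ⨁ (sorted z a b e) ≅ ⨁ (sorted z a b′ e′) × b′ ℕ.+ ∤-count (+ 13) (+ q) ≡ suc b
  absorb-13 b q e q∣ with ∣prime*⇒ 13-prime q∣
  ... | inj₁ (q∣125 , 13∤q) =
    let e′ , φ = absorb-5 z a b q e q∣125
    in b , e′ , φ , trans (cong (b ℕ.+_) (∤-count-∤ (+ 13) (+ q) (13∤q ∘ ∣⇒∣ᵤ))) (ℕP.+-comm b 1)
  ... | inj₂ (q′ , refl , q′∣125) =
    let e′ , φ = absorb-5 z a b q′ e q′∣125
    in suc b , e′ ,
       -- Bézout: 13 · (-48) + 125 · 5 = 1.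
       ≅-trans (⊞-cong (ℤ/-split 13 q′ 125 (- (+ 48)) (+ 5) refl q′∣125) ≅-refl)
         (≅-trans (⊞-assoc (ℤ/ (+ 13)) (ℤ/ (+ q′)) _) (≅-trans (⊞-cong ≅-refl φ) (add-13 z a b e′))) ,
       trans (cong (suc b ℕ.+_) (∤-count-∣ (+ 13) (+ (13 ℕ.* q′)) (∣ᵤ⇒∣ (ℕD.m∣m*n q′)))) (ℕP.+-identityʳ (suc b))

-- Once the factor 2 is split off, `absorb-13` reports on the cofactor only; this carries its count
-- back to the original modulus.
∤-count-13-2* : ∀ q → ∤-count (+ 13) (+ (2 ℕ.* q)) ≡ ∤-count (+ 13) (+ q)
∤-count-13-2* q = ∤-count-cong (+ 13) (+ (2 ℕ.* q)) (+ q) cancel-2 λ 13∣q → ∣ᵤ⇒∣ (ℕD.∣n⇒∣m*n 2 (∣⇒∣ᵤ 13∣q))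
  where
  cancel-2 : + 13 ∣ + (2 ℕ.* q) → + 13 ∣ + q
  cancel-2 13∣2q with euclidsLemma 2 q 13-prime (∣⇒∣ᵤ 13∣2q)
  ... | inj₁ 13∣2 = contradiction 13∣2 (from-no (13 ℕD.∣? 2))
  ... | inj₂ 13∣q = ∣ᵤ⇒∣ 13∣q

absorb : ∀ z a b e q → q ℕD.∣ 3250 →
  ∃[ a′ ] ∃[ b′ ] ∃[ e′ ] ℤ/ (+ q) ⊞ ⨁ (sorted z a b e) ≅ ⨁ (sorted z a′ b′ e′)
    × a′ ℕ.+ ∤-count (+ 2) (+ q) ≡ suc a × b′ ℕ.+ ∤-count (+ 13) (+ q) ≡ suc b
absorb z a b e q q∣3250 with ∣prime*⇒ {k = 1625} 2-prime q∣3250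
... | inj₁ (q∣1625 , 2∤q) =
  let b′ , e′ , φ , b-count = absorb-13 z a b q e q∣1625
  in a , b′ , e′ , φ , trans (cong (a ℕ.+_) (∤-count-∤ (+ 2) (+ q) (2∤q ∘ ∣⇒∣ᵤ))) (ℕP.+-comm a 1) , b-count
... | inj₂ (q′ , refl , q′∣1625) =
  let b′ , e′ , φ , b-count = absorb-13 z a b q′ e q′∣1625
  in suc a , b′ , e′ ,
     -- Bézout: 2 · (-812) + 1625 · 1 = 1.
     ≅-trans (⊞-cong (ℤ/-split 2 q′ 1625 (- (+ 812)) (+ 1) refl q′∣1625) ≅-refl)
       (≅-trans (⊞-assoc (ℤ/ (+ 2)) (ℤ/ (+ q′)) _) (≅-trans (⊞-cong ≅-refl φ) (add-2 z a b′ e′))) ,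
     trans (cong (suc a ℕ.+_) (∤-count-∣ (+ 2) (+ (2 ℕ.* q′)) (∣ᵤ⇒∣ (ℕD.m∣m*n q′)))) (ℕP.+-identityʳ (suc a)) ,
     trans (cong (b′ ℕ.+_) (∤-count-13-2* q′)) b-count

-- For p = 2 or 13 every index has `d i` zero, a nonzero multiple of p, or prime to p. As p divides
-- 3250 once, each index of the middle kind yields exactly one summand ℤ/p, so the ranks determine
-- `a` and `b`.
record SortedForm {n} (d : Fin n → ℤ) : Set where
  field
    {z a b}  : ℕ
    e        : ℕ × ℕ × ℕ
    iso      : ⊕ℤ/ d ≅ ⨁ (sorted z a b e)
    count-0  : z ℕ.+ count (λ i → 0ℤ ∤ᵇ d i) ≡ n
    count-2  : a ℕ.+ z ℕ.+ count (λ i → (+ 2) ∤ᵇ d i) ≡ n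
    count-13 : b ℕ.+ z ℕ.+ count (λ i → (+ 13) ∤ᵇ d i) ≡ n

sortedForm : ∀ {n} (d : Fin n → ℤ) → (∀ i → ¬ d i ≡ 0ℤ → d i ∣ + 3250) → SortedForm d
sortedForm {zero}  d d∣ = record
  { z = 0 ; a = 0 ; b = 0 ; e = 0 , 0 , 0 ; iso = ⊕ℤ/-≗ (λ ()) (λ ()) ; count-0 = refl ; count-2 = refl ; count-13 = refl }
sortedForm {suc n} d d∣ with d zero ℤP.≟ 0ℤ
... | yes d₀≡0 = record
  { z = suc z ; a = a ; b = b ; e = e
  ; iso      = ≅-trans (⊕ℤ/-suc d) (≅-trans (⊞-cong (subst (λ x → ℤ/ (d zero) ≅ ℤ/ x) d₀≡0 ≅-refl) iso) (add-0 z a b e))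
  ; count-0  = cong suc (trans (cong (λ x → z ℕ.+ (x ℕ.+ count (λ i → 0ℤ ∤ᵇ d (suc i)))) (vanish 0ℤ)) count-0)
  ; count-2  = shift a (+ 2) count-2
  ; count-13 = shift b (+ 13) count-13
  }
  where
  open SortedForm (sortedForm (d ∘ suc) (d∣ ∘ suc))
  vanish : ∀ p → ∤-count p (d zero) ≡ 0
  vanish p = ∤-count-∣ p (d zero) (divides 0ℤ (trans d₀≡0 (sym (ℤP.*-zeroˡ p))))
  shift : ∀ a p → a ℕ.+ z ℕ.+ count (λ i → p ∤ᵇ d (suc i)) ≡ n → a ℕ.+ suc z ℕ.+ (∤-count p (d zero) ℕ.+ count (λ i → p ∤ᵇ d (suc i))) ≡ suc n
  shift a p eq = trans (cong₂ (λ x y → x ℕ.+ (y ℕ.+ count (λ i → p ∤ᵇ d (suc i)))) (ℕP.+-suc a z) (vanish p)) (cong suc eq)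
... | no d₀≢0 =
  let a′ , b′ , e′ , φ , a-count , b-count = absorb z a b e ℤ.∣ d zero ∣ (∣⇒∣ᵤ (d∣ zero d₀≢0))
  in record
  { z = z ; a = a′ ; b = b′ ; e = e′
  ; iso      = ≅-trans (⊕ℤ/-suc d) (≅-trans (⊞-cong (⊕ℤ/-≗ (λ _ → m∣∣m∣) (λ _ → ∣m∣∣m)) iso) φ)
  ; count-0  = trans (cong (λ x → z ℕ.+ (x ℕ.+ count (λ i → 0ℤ ∤ᵇ d (suc i)))) (∤-count-∤ 0ℤ (d zero) (d₀≢0 ∘ 0∣⇒≡0))) (trans (ℕP.+-suc z _) (cong suc count-0))
  ; count-2  = shift a a′ (+ 2) a-count count-2
  ; count-13 = shift b b′ (+ 13) b-count count-13
  }
  where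
  open SortedForm (sortedForm (d ∘ suc) (d∣ ∘ suc))
  regroup : ∀ a z x c → a ℕ.+ z ℕ.+ (x ℕ.+ c) ≡ a ℕ.+ x ℕ.+ (z ℕ.+ c)
  regroup = ℕSolver.solve-∀
  shift : ∀ a a′ p → a′ ℕ.+ ∤-count p (+ ℤ.∣ d zero ∣) ≡ suc a → a ℕ.+ z ℕ.+ count (λ i → p ∤ᵇ d (suc i)) ≡ n →
    a′ ℕ.+ z ℕ.+ (∤-count p (d zero) ℕ.+ count (λ i → p ∤ᵇ d (suc i))) ≡ suc n
  shift a a′ p a-count eq = begin
    a′ ℕ.+ z ℕ.+ (∤-count p (d zero) ℕ.+ c)             ≡⟨ cong (λ x → a′ ℕ.+ z ℕ.+ (x ℕ.+ c)) (∤-count-cong p (d zero) (+ ℤ.∣ d zero ∣) (λ p∣ → ∣-trans p∣ m∣∣m∣) (λ p∣ → ∣-trans p∣ ∣m∣∣m)) ⟩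
    a′ ℕ.+ z ℕ.+ (∤-count p (+ ℤ.∣ d zero ∣) ℕ.+ c)     ≡⟨ regroup a′ z (∤-count p (+ ℤ.∣ d zero ∣)) c ⟩
    a′ ℕ.+ ∤-count p (+ ℤ.∣ d zero ∣) ℕ.+ (z ℕ.+ c)     ≡⟨ cong (ℕ._+ (z ℕ.+ c)) a-count ⟩
    suc (a ℕ.+ (z ℕ.+ c))                               ≡⟨ cong suc (trans (sym (ℕP.+-assoc a z c)) eq) ⟩
    suc n                                               ∎
    where
    open ≡-Reasoning
    c = count (λ i → p ∤ᵇ d (suc i))

-- The critical group

module _ {n m} {H : (Fin n → ℤ) → Set} {K : (Fin m → ℤ) → Set} (H-sub : IsSubgroup H) (K-sub : IsSubgroup K)
  (φ : quotient H-sub ≅ quotient K-sub) where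
  open _≅_ φ
  private
    module A = AbelianGroup (quotient H-sub)
    module B = AbelianGroup (quotient K-sub)

  to-ε : to A.ε B.≈ B.ε
  to-ε = GroupProperties.identityˡ-unique B.group (to A.ε) (to A.ε)
    (B.trans (B.sym (to-∙ A.ε A.ε)) (to-cong (A.identityˡ A.ε)))

  to-* : ∀ c x → to (λ i → + c * x i) B.≈ λ i → + c * to x i
  to-* zero    x = B.trans (to-cong (≗⇒congruent H-sub λ i → ℤP.*-zeroˡ (x i)))
    (B.trans to-ε (≗⇒congruent K-sub λ i → sym (ℤP.*-zeroˡ (to x i))))
  to-* (suc c) x = B.trans (to-cong (≗⇒congruent H-sub λ i → ℤP.suc-* (+ c) (x i)))
    (B.trans (to-∙ x (λ i → + c * x i))
    (B.trans (B.∙-cong (B.refl {to x}) (to-* c x))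
    (≗⇒congruent K-sub λ i → sym (ℤP.suc-* (+ c) (to x i)))))

  to-injective-ε : ∀ x → to x B.≈ B.ε → x A.≈ A.ε
  to-injective-ε x to-x≈ε = A.trans (A.sym (from-to x)) (A.trans (from-cong (B.trans to-x≈ε (B.sym to-ε))) (from-to A.ε))

-- The torsion of ℤ plus a finite group consists of the tuples with head 0. The exponent is written
-- `suc N` because `IsTorsion` records the multiplier `suc m` through `m`.
module _ {n k} (Γ : Graph n) (moore : IsMoore Γ 2 k) (N : ℕ) (ms : List ℕ) (ms∣N : All (ℕD._∣ suc N) ms)
  (φ : coker (MooreGraph.Lap Γ k moore) ≅ ⨁ (0 ∷ ms)) where
  open MooreGraph Γ k moore using (Lap; Laplacian≡)
  open _≅_ φ
  private
    module A = AbelianGroup (coker Lap)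
    module B = AbelianGroup (⨁ (0 ∷ ms))
    H-sub = Image-isSubgroup Lap
    K-sub = ∣-isSubgroup (moduli (0 ∷ ms))

  private
    to-InImL : ∀ {x y} → x ≗ y → Image Lap x → InImL Γ y
    to-InImL x≗y (z , Lz) = z , λ i → trans (Laplacian≡ z i) (trans (Lz i) (x≗y i))

    from-InImL : ∀ {x} → InImL Γ x → Image Lap x
    from-InImL (z , Lz) = z , λ i → trans (sym (Laplacian≡ z i)) (Lz i)

    -- The head has modulus 0, so a positive multiple that is congruent to zero there is equal to
    -- zero, and ℤ has no zero divisors.
    torsion⇒head≡0 : ∀ x → IsTorsion Γ x → to x zero ≡ 0ℤ
    torsion⇒head≡0 x (m , mx∈) = Sum.[ (λ ()) , id ]′ (ℤP.i*j≡0⇒i≡0∨j≡0 (+ suc m) {to x zero} (trans (sym (ℤP.+-identityʳ _)) (0∣⇒≡0 (Congruent.difference mto-x≈0 zero))))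
      where
      mx≈0 : (λ i → + suc m * x i) A.≈ A.ε
      mx≈0 = congruent (IsSubgroup.resp H-sub (λ i → sym (ℤP.+-identityʳ (+ suc m * x i))) (from-InImL mx∈))
      mto-x≈0 : (λ i → + suc m * to x i) B.≈ B.ε
      mto-x≈0 = B.trans (B.sym (to-* H-sub K-sub φ (suc m) x)) (B.trans (to-cong mx≈0) (to-ε H-sub K-sub φ))

    -- `suc N` annihilates every coordinate after the head, and the head is 0; the isomorphism
    -- carries this multiple back to zero in the cokernel.
    torsion : ∀ y → IsTorsion Γ (from (0ℤ ∷ᶠ y))
    torsion y = N , to-InImL (λ i → ℤP.+-identityʳ _) (Congruent.difference (to-injective-ε H-sub K-sub φ (λ i → + suc N * x i)
      (B.trans (to-* H-sub K-sub φ (suc N) x) (B.trans N-to-x≈ N-y≈0))))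
      where
      x = from (0ℤ ∷ᶠ y)
      factor : ∀ a b c → a * b - a * c ≡ a * (b - c)
      factor a b c = sym (trans (ℤP.*-distribˡ-+ a b (- c)) (cong (_+_ (a * b)) (sym (ℤP.neg-distribʳ-* a c))))
      N-to-x≈ : (λ i → + suc N * to x i) B.≈ λ i → + suc N * (0ℤ ∷ᶠ y) i
      N-to-x≈ = congruent λ i → subst (moduli (0 ∷ ms) i ∣_) (sym (factor (+ suc N) (to x i) ((0ℤ ∷ᶠ y) i)))
        (∣n⇒∣m*n (+ suc N) (Congruent.difference (to-from (0ℤ ∷ᶠ y)) i))
      N-y≈0 : (λ i → + suc N * (0ℤ ∷ᶠ y) i) B.≈ B.ε
      N-y≈0 = congruent λ where
        zero    → divides 0ℤ (trans (ℤP.+-identityʳ _) (ℤP.*-zeroʳ (+ suc N)))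
        (suc i) → subst (+ lookup ms i ∣_) (sym (ℤP.+-identityʳ (+ suc N * y i))) (∣m⇒∣m*n {m = + suc N} (y i) (∣ᵤ⇒∣ (All.lookup ms∣N (∈-lookup i))))

    0∷-cong : ∀ {y y′ : Fin (length ms) → ℤ} → (∀ i → + lookup ms i ∣ y i - y′ i) → (0ℤ ∷ᶠ y) B.≈ (0ℤ ∷ᶠ y′)
    0∷-cong p = congruent λ { zero → divides 0ℤ refl ; (suc i) → p i }

  criticalGroupIso : CriticalGroupIso Γ ms
  criticalGroupIso = record
    { to        = λ x → to x ∘ suc
    ; from      = λ y → from (0ℤ ∷ᶠ y)
    ; from-tors = torsion
    ; to-cong   = λ x y _ _ x≈y i → ∣⇒∣ᵤ (Congruent.difference (to-cong {x} {y} (congruent (from-InImL x≈y))) (suc i))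
    ; to-hom    = λ x y _ _ i → ∣⇒∣ᵤ (Congruent.difference (to-∙ x y) (suc i))
    ; from-cong = λ y y′ y≈y′ → to-InImL (λ _ → refl) (Congruent.difference (from-cong (0∷-cong {y} {y′} λ i → ∣ᵤ⇒∣ (y≈y′ i))))
    ; to-from   = λ y i → ∣⇒∣ᵤ (Congruent.difference (to-from (0ℤ ∷ᶠ y)) (suc i))
    -- On torsion elements the head dropped by the forward map was 0, so prepending `0ℤ` restores
    -- `to x`.
    ; from-to   = λ x tors → to-InImL (λ _ → refl) (Congruent.difference (A.trans
        (from-cong (≗⇒congruent K-sub λ { zero → sym (torsion⇒head≡0 x tors) ; (suc i) → refl }))
        (from-to x)))
    }

+-prime : ∀ {p} → Prime p → ∀ a b → + p ∣ a * b → + p ∣ a ⊎ + p ∣ b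
+-prime {p} p-prime a b p∣ab = Sum.map ∣ᵤ⇒∣ ∣ᵤ⇒∣ (euclidsLemma _ _ p-prime (subst (p ℕD.∣_) (ℤP.abs-* a b) (∣⇒∣ᵤ p∣ab)))

-- Valency 57

module MooreGraph57 {n} (Γ : Graph n) (moore : IsMoore Γ 2 57) where
  open MooreGraph Γ 57 moore

  private
    u : Fin n
    -- One of the two vertices that witness that the diameter is not smaller than 2.
    u = proj₁ (proj₂ (proj₁ (proj₂ moore)))

    d : Fin n → ℤ
    d = proj₁ (diagonalise Lap)

    Lap~ : Lap ~ diag d
    Lap~ = proj₂ (diagonalise Lap)

    n≡3250 : n ≡ 3250
    n≡3250 = ℤP.+-injective (size u)

    trace : tr Lap ≡ + 185250
    trace = trans tr-Lap (cong (λ m → + m * + 57) n≡3250)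

    -- `A` has the eigenvalues -8 and 7 besides the valency, the roots of x² + x - 56, so `Lap` has
    -- 57 + 8 and 57 - 7.
    65-50 : LaplacianRelations Lap (+ 65) (+ 50)
    65-50 = relations u (+ 65) (+ 50) refl refl

    50-65 : LaplacianRelations Lap (+ 50) (+ 65)
    50-65 = relations u (+ 50) (+ 65) refl refl

    rank₀ : count (λ i → 0ℤ ∤ᵇ d i) ≡ 3249
    rank₀ = rank-ℚ Lap (+ 65) (+ 50) 65-50 d 3249 Lap~ (λ ()) refl

    -- The odd eigenvalue 65 takes the place of `ℓ`. The scaling factor is 65 · 15 = 975, and 1521
    -- is its multiplicity 1520 plus one for the all-ones vector.
    rank₂ : count (λ i → + 2 ∤ᵇ d i) ≡ 1521
    rank₂ = rank-mod Lap (+ 65) (+ 50) 65-50 (+ 2) (+-prime 2-prime) (divides (+ 1625) refl)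
      (from-no (+ 2 ∣? + 65)) (from-no (+ 2 ∣? + 975)) u d 1521 Lap~
      (cong (λ t → - (+ 3250) * + 3250 + + 65 * t + + 3250 + + 975) trace)

    -- The eigenvalues change roles, since 13 divides 65. The scaling factor is 50 · (-15) = -750,
    -- and 1730 is the multiplicity 1729 plus one.
    rank₁₃ : count (λ i → + 13 ∤ᵇ d i) ≡ 1730
    rank₁₃ = rank-mod Lap (+ 50) (+ 65) 50-65 (+ 13) (+-prime 13-prime) (divides (+ 250) refl)
      (from-no (+ 13 ∣? + 50)) (from-no (+ 13 ∣? - (+ 750))) u d 1730 Lap~
      (cong (λ t → - (+ 3250) * + 3250 + + 50 * t + + 3250 + - (+ 750)) trace)

    form : SortedForm d
    form = sortedForm d (L-diagonal-divides Lap (+ 65) (+ 50) 65-50 d Lap~)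

  open SortedForm form

  z≡1 : z ≡ 1
  z≡1 = ℕP.+-cancelʳ-≡ 3249 z 1 (trans (cong (z ℕ.+_) (sym rank₀)) (trans count-0 n≡3250))

  multiplicity : ∀ a r a′ {c} → a ℕ.+ z ℕ.+ c ≡ n → c ≡ r → a′ ℕ.+ 1 ℕ.+ r ≡ 3250 → a ≡ a′
  multiplicity a r a′ eq refl eq′ = ℕP.+-cancelʳ-≡ 1 a a′ (ℕP.+-cancelʳ-≡ r (a ℕ.+ 1) (a′ ℕ.+ 1)
    (trans (cong (λ x → a ℕ.+ x ℕ.+ r) (sym z≡1)) (trans eq (trans n≡3250 (sym eq′)))))

  a≡1728 : a ≡ 1728
  a≡1728 = multiplicity a 1521 1728 count-2 rank₂ refl

  b≡1519 : b ≡ 1519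
  b≡1519 = multiplicity b 1730 1519 count-13 rank₁₃ refl

  e₁ e₂ e₃ : ℕ
  e₁ = proj₁ e
  e₂ = proj₁ (proj₂ e)
  e₃ = proj₂ (proj₂ e)

  divides-3250 : All (ℕD._∣ 3250) (replicate a 2 ++ replicate b 13 ++ 5-part e)
  divides-3250 =
    AllP.++⁺ (AllP.replicate⁺ a (from-yes (2 ℕD.∣? 3250)))
    (AllP.++⁺ (AllP.replicate⁺ b (from-yes (13 ℕD.∣? 3250)))
    (AllP.++⁺ (AllP.replicate⁺ e₁ (from-yes (5 ℕD.∣? 3250)))
    (AllP.++⁺ (AllP.replicate⁺ e₂ (from-yes (25 ℕD.∣? 3250)))
    (AllP.replicate⁺ e₃ (from-yes (125 ℕD.∣? 3250))))))

  coker≅ : coker Lap ≅ ⨁ (0 ∷ replicate a 2 ++ replicate b 13 ++ 5-part e)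
  coker≅ = subst (λ z → coker Lap ≅ ⨁ (sorted z a b e)) z≡1 (≅-trans (coker-diagonal Lap d Lap~) iso)

  iso-ab : CriticalGroupIso Γ (replicate a 2 ++ replicate b 13 ++ 5-part e)
  -- The exponent is `suc 3249`, that is 3250.
  iso-ab = criticalGroupIso Γ moore 3249 _ divides-3250 coker≅

theoremA : ∀ {n} (Γ : Graph n) → IsMoore Γ 2 57 →
    ∃[ e₁ ] ∃[ e₂ ] ∃[ e₃ ] CriticalGroupIso Γ
    (replicate 1728 2 ++ replicate 1519 13 ++ replicate e₁ 5 ++ replicate e₂ 25 ++ replicate e₃ 125)
theoremA Γ moore = e₁ , e₂ , e₃ ,
  subst₂ (λ a b → CriticalGroupIso Γ (replicate a 2 ++ replicate b 13 ++ replicate e₁ 5 ++ replicate e₂ 25 ++ replicate e₃ 125))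
    {y = 1728} {v = 1519} a≡1728 b≡1519 iso-ab
  where open MooreGraph57 Γ moore
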